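{- A lattice simplex $\Delta$ is spanning if and only if the corresponding linear code $C_\Delta$ can be generated by a matrix $g$ whose rows have height one.
   Context: Let $M\cong\mathbb{Z}^d$ be a lattice and $\Delta$ a $d$-dimensional lattice simplex in $M\otimes\mathbb{R}$ with vertices $v_0,\dots,v_d\in M$. $\Delta$ is spanning if every point of $M\oplus\mathbb{Z}$ is an integer linear combination of the lattice points of $\Delta\times\{1\}$. Code of a simplex: $\mathbb{Z}_N=\mathbb{Z}/N\mathbb{Z}$, with elements identified with the representatives $0,\dots,N-1$. Let $\Lambda_\Delta=\{x\in(\mathbb{R}/\mathbb{Z})^{d+1}:\sum_i\{x_i\}(v_i,1)\in M\oplus\mathbb{Z}\}$, where $\{\cdot\}$ is the fractional part. $N_\Delta$ is the least common multiple of the denominators of all coordinates of elements of $\Lambda_\Delta$, and $C_\Delta=\{(N_\Delta\{x_0\},\dots,N_\Delta\{x_d\}):x\in\Lambda_\Delta\}\subseteq\mathbb{Z}_{N_\Delta}^{d+1}$, a submodule all of whose words have coordinate sum $0\bmod N_\Delta$. The height of a word $c\in C_\Delta$ is the integer $\frac1{N_\Delta}\sum_{i=0}^d c_i$ (sum of the representatives). $C_\Delta$ is generated by $g$ if it is the submodule generated by the rows of $g$; the zero code is regarded as generated by the empty matrix (no rows). -}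

module Defs where

open import Algebra.Bundles using (CommutativeMonoid; CommutativeSemigroup; RawMonoid)
import Algebra.Definitions.RawMonoid as RawMonoidDefinitions
open import Algebra.Properties.CommutativeSemigroup using (interchange)
open import Data.Fin.Base using (Fin; toℕ)
open import Data.Integer.Base as ℤ using (ℤ; +_)
open import Data.Nat.Base as ℕ using (ℕ; suc; NonZero)
open import Data.Nat.Divisibility using (_∣_)
open import Data.Nat.DivMod using (_mod_)
import Data.Nat.Properties as ℕₚ
open import Data.Product.Base using (_×_; _,_; ∃-syntax; Σ-syntax; proj₁; proj₂)
open import Data.Rational.Base as ℚ using (ℚ; 0ℚ; 1ℚ; ½; ∣_∣; ↧ₙ_)
import Data.Rational.Properties as ℚₚ
open import Data.Vec.Functional using (Vector)
open import Function.Base using (_∘_)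
open import Function.Bundles using (_⇔_)
open import Level using (0ℓ)
open import Relation.Binary.PropositionalEquality using (_≡_; refl; sym; trans; cong; subst)

------------------------------------------------------------------------
-- Real numbers: Cauchy sequences of rationals, with setoid equality _≃_.
-- Only the ℚ-vector space structure and the order of ℝ are needed, since
-- real scalars are only ever multiplied with integer vectors.

infix  4 _≃_ _≤ᴿ_ _<ᴿ_
infixl 6 _+ᴿ_
infixr 7 _·_

IsCauchy : (ℕ → ℚ) → Set
IsCauchy s = ∀ ε → 0ℚ ℚ.< ε →
  ∃[ K ] (∀ m n → K ℕ.≤ m → K ℕ.≤ n → ∣ s m ℚ.- s n ∣ ℚ.< ε)

record ℝ : Set where
  constructor mkℝ
  field
    seq    : ℕ → ℚ
    cauchy : IsCauchy seq
open ℝ public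

_≃_ : ℝ → ℝ → Set
x ≃ y = ∀ ε → 0ℚ ℚ.< ε → ∃[ K ] (∀ n → K ℕ.≤ n → ∣ seq x n ℚ.- seq y n ∣ ℚ.< ε)

_≤ᴿ_ : ℝ → ℝ → Set
x ≤ᴿ y = ∀ ε → 0ℚ ℚ.< ε → ∃[ K ] (∀ n → K ℕ.≤ n → seq x n ℚ.< seq y n ℚ.+ ε)

_<ᴿ_ : ℝ → ℝ → Set
x <ᴿ y = ∃[ ε ] (0ℚ ℚ.< ε × ∃[ K ] (∀ n → K ℕ.≤ n → seq x n ℚ.+ ε ℚ.< seq y n))

fromℚ : ℚ → ℝ
fromℚ q = mkℝ (λ _ → q) λ ε 0<ε →
  0 , λ _ _ _ _ → subst (ℚ._< ε) (sym (cong ∣_∣ (ℚₚ.+-inverseʳ q))) 0<ε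

ℤ→ℚ : ℤ → ℚ
ℤ→ℚ k = k ℚ./ 1

fromℤ : ℤ → ℝ
fromℤ k = fromℚ (ℤ→ℚ k)

abstract
  IsCauchy-+ : ∀ x y → IsCauchy (λ n → seq x n ℚ.+ seq y n)
  IsCauchy-+ x y ε 0<ε =
    let 0<ε/2   = subst (ℚ._< ½ ℚ.* ε) (ℚₚ.*-zeroʳ ½) (ℚₚ.*-monoʳ-<-pos ½ 0<ε)
        K₁ , c₁ = cauchy x (½ ℚ.* ε) 0<ε/2
        K₂ , c₂ = cauchy y (½ ℚ.* ε) 0<ε/2
    in K₁ ℕ.⊔ K₂ , λ m n K≤m K≤n →
       close (seq x m) (seq x n) (seq y m) (seq y n)
         (c₁ m n (ℕₚ.m⊔n≤o⇒m≤o K₁ K₂ K≤m) (ℕₚ.m⊔n≤o⇒m≤o K₁ K₂ K≤n))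
         (c₂ m n (ℕₚ.m⊔n≤o⇒n≤o K₁ K₂ K≤m) (ℕₚ.m⊔n≤o⇒n≤o K₁ K₂ K≤n))
    where
    ℚ-+ : CommutativeSemigroup 0ℓ 0ℓ
    ℚ-+ = CommutativeMonoid.commutativeSemigroup ℚₚ.+-0-commutativeMonoid

    regroup : ∀ a b c d → (a ℚ.+ c) ℚ.- (b ℚ.+ d) ≡ (a ℚ.- b) ℚ.+ (c ℚ.- d)
    regroup a b c d = trans (cong ((a ℚ.+ c) ℚ.+_) (ℚₚ.neg-distrib-+ b d))
                            (interchange ℚ-+ a c (ℚ.- b) (ℚ.- d))

    halves : ½ ℚ.* ε ℚ.+ ½ ℚ.* ε ≡ ε
    halves = trans (sym (ℚₚ.*-distribʳ-+ ε ½ ½)) (ℚₚ.*-identityˡ ε)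

    close : ∀ a b c d → ∣ a ℚ.- b ∣ ℚ.< ½ ℚ.* ε → ∣ c ℚ.- d ∣ ℚ.< ½ ℚ.* ε →
            ∣ (a ℚ.+ c) ℚ.- (b ℚ.+ d) ∣ ℚ.< ε
    close a b c d p q = begin-strict
      ∣ (a ℚ.+ c) ℚ.- (b ℚ.+ d) ∣     ≡⟨ cong ∣_∣ (regroup a b c d) ⟩
      ∣ (a ℚ.- b) ℚ.+ (c ℚ.- d) ∣     ≤⟨ ℚₚ.∣p+q∣≤∣p∣+∣q∣ (a ℚ.- b) (c ℚ.- d) ⟩
      ∣ a ℚ.- b ∣ ℚ.+ ∣ c ℚ.- d ∣     <⟨ ℚₚ.+-mono-< p q ⟩
      ½ ℚ.* ε ℚ.+ ½ ℚ.* ε             ≡⟨ halves ⟩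
      ε                               ∎
      where open ℚₚ.≤-Reasoning

_+ᴿ_ : ℝ → ℝ → ℝ
x +ᴿ y = mkℝ (λ n → seq x n ℚ.+ seq y n) (IsCauchy-+ x y)

abstract
  IsCauchy-* : ∀ q x → IsCauchy (λ n → q ℚ.* seq x n)
  IsCauchy-* q x ε 0<ε =
    let δ     = (ℚ.1/ B) ℚ.* ε
        0<δ   = subst (ℚ._< δ) (ℚₚ.*-zeroʳ (ℚ.1/ B)) (ℚₚ.*-monoʳ-<-pos (ℚ.1/ B) 0<ε)
        K , c = cauchy x δ 0<δ
    in K , λ m n K≤m K≤n → close (seq x m) (seq x n) (c m n K≤m K≤n)
    where
    B : ℚ
    B = ∣ q ∣ ℚ.+ 1ℚ

    instance
      B>0 : ℚ.Positive B
      B>0 = ℚₚ.nonNeg+pos⇒pos ∣ q ∣ {{ℚₚ.∣-∣-nonNeg q}} 1ℚ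
      B≢0 : ℚ.NonZero B
      B≢0 = ℚₚ.pos⇒nonZero B
      1/B>0 : ℚ.Positive (ℚ.1/ B)
      1/B>0 = ℚₚ.1/pos⇒pos B

    factor : ∀ a b → q ℚ.* a ℚ.- q ℚ.* b ≡ q ℚ.* (a ℚ.- b)
    factor a b = trans (cong (q ℚ.* a ℚ.+_) (ℚₚ.neg-distribʳ-* q b))
                       (sym (ℚₚ.*-distribˡ-+ q a (ℚ.- b)))

    ∣q∣≤B : ∣ q ∣ ℚ.≤ B
    ∣q∣≤B = subst (ℚ._≤ B) (ℚₚ.+-identityʳ ∣ q ∣)
      (ℚₚ.+-monoʳ-≤ ∣ q ∣ (ℚₚ.<⇒≤ (ℚₚ.positive⁻¹ 1ℚ)))

    close : ∀ a b → ∣ a ℚ.- b ∣ ℚ.< (ℚ.1/ B) ℚ.* ε →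
            ∣ q ℚ.* a ℚ.- q ℚ.* b ∣ ℚ.< ε
    close a b p = begin-strict
      ∣ q ℚ.* a ℚ.- q ℚ.* b ∣      ≡⟨ cong ∣_∣ (factor a b) ⟩
      ∣ q ℚ.* (a ℚ.- b) ∣          ≡⟨ ℚₚ.∣p*q∣≡∣p∣*∣q∣ q (a ℚ.- b) ⟩
      ∣ q ∣ ℚ.* ∣ a ℚ.- b ∣        ≤⟨ ℚₚ.*-monoʳ-≤-nonNeg ∣ a ℚ.- b ∣
                                        {{ℚₚ.∣-∣-nonNeg (a ℚ.- b)}} ∣q∣≤B ⟩
      B ℚ.* ∣ a ℚ.- b ∣            <⟨ ℚₚ.*-monoʳ-<-pos B p ⟩
      B ℚ.* ((ℚ.1/ B) ℚ.* ε)       ≡⟨ sym (ℚₚ.*-assoc B (ℚ.1/ B) ε) ⟩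
      (B ℚ.* (ℚ.1/ B)) ℚ.* ε       ≡⟨ cong (ℚ._* ε) (ℚₚ.*-inverseʳ B) ⟩
      1ℚ ℚ.* ε                     ≡⟨ ℚₚ.*-identityˡ ε ⟩
      ε                            ∎
      where open ℚₚ.≤-Reasoning

_·_ : ℚ → ℝ → ℝ
q · x = mkℝ (λ n → q ℚ.* seq x n) (IsCauchy-* q x)

+ᴿ-rawMonoid : RawMonoid 0ℓ 0ℓ
+ᴿ-rawMonoid = record { Carrier = ℝ ; _≈_ = _≃_ ; _∙_ = _+ᴿ_ ; ε = fromℚ 0ℚ }

open RawMonoidDefinitions +ᴿ-rawMonoid public using () renaming (sum to ∑ᴿ)
open RawMonoidDefinitions ℤ.+-0-rawMonoid public using () renaming (sum to ∑ᶻ)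
open RawMonoidDefinitions ℕ.+-0-rawMonoid public using () renaming (sum to ∑ᴺ)

------------------------------------------------------------------------
-- Lattice simplices.  M = ℤᵈ and M ⊗ ℝ = ℝᵈ.

M : ℕ → Set
M d = Vector ℤ d

M⊕ℤ : ℕ → Set
M⊕ℤ d = M d × ℤ

comb : ∀ {d n} → Vector ℝ n → Vector (M d) n → Vector ℝ d
comb t v j = ∑ᴿ λ i → ℤ→ℚ (v i j) · t i

AffinelyIndependent : ∀ {d n} → Vector (M d) n → Set
AffinelyIndependent {n = n} v = (t : Vector ℝ n) →
  ∑ᴿ t ≃ fromℚ 0ℚ →
  (∀ j → comb t v j ≃ fromℚ 0ℚ) →
  ∀ i → t i ≃ fromℚ 0ℚ

record LatticeSimplex (d : ℕ) : Set where
  field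
    vertex              : Vector (M d) (suc d)
    affinelyIndependent : AffinelyIndependent vertex
open LatticeSimplex public

_∈Simplex_ : ∀ {d} → Vector ℝ d → LatticeSimplex d → Set
y ∈Simplex Δ = ∃[ t ] ((∀ i → fromℚ 0ℚ ≤ᴿ t i)
                     × ∑ᴿ t ≃ fromℚ 1ℚ
                     × (∀ j → y j ≃ comb t (vertex Δ) j))

IsLatticePointOfΔ×1 : ∀ {d} → LatticeSimplex d → M⊕ℤ d → Set
IsLatticePointOfΔ×1 Δ (p , h) = ((fromℤ ∘ p) ∈Simplex Δ) × h ≡ + 1

IsIntegerCombination : ∀ {d k} → M⊕ℤ d → Vector (M⊕ℤ d) k → Set
IsIntegerCombination {k = k} (m , h) p =
  Σ[ a ∈ Vector ℤ k ] ((∀ j → m j ≡ ∑ᶻ λ i → a i ℤ.* proj₁ (p i) j)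
                     × h ≡ ∑ᶻ λ i → a i ℤ.* proj₂ (p i))

Spanning : ∀ {d} → LatticeSimplex d → Set
Spanning {d} Δ = (q : M⊕ℤ d) →
  ∃[ k ] Σ[ p ∈ Vector (M⊕ℤ d) k ] ((∀ i → IsLatticePointOfΔ×1 Δ (p i))
                                  × IsIntegerCombination q p)

------------------------------------------------------------------------
-- The code of a simplex

-- f = {x}, stated as a relation because the fractional part is not a
-- computable function on ℝ.
IsFractionalPart : ℝ → ℝ → Set
IsFractionalPart x f = fromℚ 0ℚ ≤ᴿ f × f <ᴿ fromℚ 1ℚ × ∃[ k ] (x ≃ fromℤ k +ᴿ f)

-- An element of (ℝ/ℤ)ᵈ⁺¹ is given by an arbitrary tuple x of real
-- representatives; membership depends on x only modulo ℤᵈ⁺¹.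
record _∈Λ_ {d : ℕ} (x : Vector ℝ (suc d)) (Δ : LatticeSimplex d) : Set where
  field
    frac             : Vector ℝ (suc d)
    isFractionalPart : ∀ i → IsFractionalPart (x i) (frac i)
    point            : M d
    level            : ℤ
    point-eq         : ∀ j → comb frac (vertex Δ) j ≃ fromℤ (point j)
    level-eq         : ∑ᴿ frac ≃ fromℤ level
open _∈Λ_ public

-- ℚ is kept in lowest terms, so ↧ₙ q is the reduced denominator; it is
-- unchanged by adding an integer to x.
IsDenominator : ℝ → ℕ → Set
IsDenominator x n = ∃[ q ] (x ≃ fromℚ q × n ≡ ↧ₙ q)

record IsLCM (S : ℕ → Set) (N : ℕ) : Set where
  field
    commonMultiple : ∀ {n} → S n → n ∣ N
    least          : ∀ {m} → (∀ {n} → S n → n ∣ m) → N ∣ m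

IsN : ∀ {d} → LatticeSimplex d → ℕ → Set
IsN Δ = IsLCM λ n → ∃[ x ] (x ∈Λ Δ × ∃[ i ] IsDenominator (x i) n)

-- Words over ℤ/N; toℕ gives the representative in {0,…,N-1}.
Word : ℕ → ℕ → Set
Word N n = Vector (Fin N) n

InCode : ∀ {d} → LatticeSimplex d → (N : ℕ) → Word N (suc d) → Set
InCode Δ N c = ∃[ x ] Σ[ x∈Λ ∈ x ∈Λ Δ ]
  (∀ i → fromℤ (+ toℕ (c i)) ≃ ℤ→ℚ (+ N) · frac x∈Λ i)

height : ∀ {N n} .{{_ : NonZero N}} → Word N n → ℚ
height {N} c = (+ ∑ᴺ (toℕ ∘ c)) ℚ./ N

_∈RowSpan_ : ∀ {N n r} .{{_ : NonZero N}} → Word N n → Vector (Word N n) r → Set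
_∈RowSpan_ {N} {r = r} c g = Σ[ a ∈ Vector (Fin N) r ] (∀ i →
  c i ≡ (∑ᴺ λ j → toℕ (a j) ℕ.* toℕ (g j i)) mod N)

Generates : ∀ {d r} → LatticeSimplex d → (N : ℕ) .{{_ : NonZero N}} →
            Vector (Word N (suc d)) r → Set
Generates Δ N g = ∀ c → (c ∈RowSpan g) ⇔ InCode Δ N c

{-# OPTIONS --safe #-}

-- Let A be the matrix with columns (vᵢ , 1).  Every lattice point q is A t for
-- a unique rational t, and the fractional part of t lies in Λ, so that N t is
-- integral: lattice points correspond to the integer vectors z with
-- A z ∈ N ℤᵈ⁺¹, and the code consists of these vectors modulo N.  A lattice
-- point of Δ × {1} which is not a vertex corresponds to a codeword of height
-- one, and the vertices to the vectors N eᵢ, which vanish modulo N.  Hence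
-- the lattice points of Δ × {1} generate M ⊕ ℤ if and only if the codewords
-- of height one generate the code.
module Submission where

open import Defs
open import Data.Nat.Base using (ℕ; suc; NonZero)
open import Data.Product.Base using (_×_; ∃-syntax; Σ-syntax)
open import Data.Rational.Base using (1ℚ)
open import Data.Vec.Functional using (Vector)
open import Function.Bundles using (_⇔_)
open import Relation.Binary.PropositionalEquality using (_≡_)

open import Algebra.Bundles using (CommutativeRing)
import Algebra.Properties.CommutativeMonoid.Sum as CommutativeMonoidSum
import Algebra.Properties.Semiring.Sum as SemiringSum
open import Data.Empty using (⊥-elim)
open import Data.Fin.Base using (Fin; zero; suc; toℕ; fromℕ<; _↑ˡ_; _↑ʳ_; punchIn; punchOut; finToFun; funToFin)
open import Data.Fin.Properties as Finₚ using (toℕ<n; toℕ-fromℕ<; toℕ-injective; all?; ¬∀⟶∃¬; finToFun-funToFin; punchIn-punchOut)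
open import Data.Integer.Base as ℤ using (ℤ; +_; -[1+_]; 0ℤ; 1ℤ)
import Data.Integer.Divisibility.Signed as ℤ-Div
import Data.Integer.DivMod as ℤ-DivMod
import Data.Integer.Properties as ℤₚ
open import Data.Integer.Tactic.RingSolver using (solve-∀)
open import Data.List.Base using (List; length; lookup; filter; allFin)
open import Data.List.Membership.Propositional.Properties using (∈-allFin; ∈-filter⁺; ∈-filter⁻; ∈-lookup)
open import Data.List.Relation.Unary.Any using (index)
open import Data.List.Relation.Unary.Any.Properties using (lookup-index)
open import Data.Nat.Base as ℕ using (zero)
import Data.Nat.Coprimality as Coprimality
open import Data.Nat.Divisibility using (_∣_; quotient)
open import Data.Nat.DivMod using (_mod_; _%_; _/_; m%n<n; m≡m%n+[m/n]*n; [m+kn]%n≡m%n; m<n⇒m%n≡m)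
import Data.Nat.Properties as ℕₚ
open import Data.Product.Base using (_,_; proj₁; proj₂)
open import Data.Rational.Base as ℚ using (ℚ; mkℚ; 0ℚ; ½; ∣_∣; ↧ₙ_; ↥_; toℚᵘ)
import Data.Rational.Properties as ℚₚ
open import Data.Rational.Solver using (module +-*-Solver)
import Data.Rational.Unnormalised.Base as ℚᵘ
import Data.Rational.Unnormalised.Properties as ℚᵘₚ
open import Data.Sum.Base using (inj₁; inj₂; [_,_])
open import Data.Vec.Functional using (_∷_; _++_; insertAt)
open import Data.Vec.Functional.Properties using (insertAt-lookup; insertAt-punchIn; lookup-++ˡ; lookup-++ʳ)
open import Data.Vec.Functional.Relation.Unary.All.Properties using (++⁺)
open import Function.Base using (_∘_; _$_)
open import Function.Bundles using (mk⇔; Equivalence)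
open import Relation.Binary.Definitions using (tri<; tri≈; tri>)
open import Relation.Binary.PropositionalEquality using (_≢_; refl; sym; trans; cong; cong₂; subst; subst₂; module ≡-Reasoning)
open import Relation.Nullary.Decidable using (Dec; yes; no; _×-dec_)

open SemiringSum ℤₚ.+-*-semiring using (sum-cong-≗; sum-remove; ∑-distrib-+; ∑-comm; *-distribˡ-sum; sum-replicate-zero)
module ℚ-Sum = SemiringSum (CommutativeRing.semiring ℚₚ.+-*-commutativeRing)
module ℕ-Sum = CommutativeMonoidSum ℕₚ.+-0-commutativeMonoid

-- Linear algebra over ℤ

-- Membership in Δ, Λ and the code concerns Cauchy reals, on which neither equality nor the floor
-- can be decided, so the unique t is never extracted from a real witness. Affine independence,
-- evaluated at constant sequences, shows that A has trivial integer kernel; elimination over ℤ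
-- gives a rational preimage of each lattice point without any real data, and the defining property
-- of N turns it into an integer vector z. A real solution t of the same system satisfies N t = z by
-- affine independence once more, and through that equation signs and exact equalities pass from ℝ
-- to ℤ. The generators must moreover form a finite matrix: the words of height one are filtered
-- from all words by divisibility of A c by N, an integer condition that can be decided. Congruences
-- modulo N are carried as integer equations with an explicit multiple N k, since A k is exactly the
-- combination of vertices lost in the reduction.

infixl 7 _*ᵛ_

_*ᵛ_ : ∀ {m n} → (Fin m → Vector ℤ n) → Vector ℤ n → Vector ℤ m
(A *ᵛ z) r = ∑ᶻ λ i → A r i ℤ.* z i

∑ᶻ-zero : ∀ {n} {z : Vector ℤ n} → (∀ i → z i ≡ 0ℤ) → ∑ᶻ z ≡ 0ℤ
∑ᶻ-zero {n} z≡0 = trans (sum-cong-≗ z≡0) (sum-replicate-zero n)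

module _ {m n} (A : Fin m → Vector ℤ n) where

  *ᵛ-cong : ∀ {x y} → (∀ i → x i ≡ y i) → ∀ r → (A *ᵛ x) r ≡ (A *ᵛ y) r
  *ᵛ-cong x≗y r = sum-cong-≗ λ i → cong (A r i ℤ.*_) (x≗y i)

  *ᵛ-+ : ∀ x y r → (A *ᵛ λ i → x i ℤ.+ y i) r ≡ (A *ᵛ x) r ℤ.+ (A *ᵛ y) r
  *ᵛ-+ x y r = trans (sum-cong-≗ λ i → ℤₚ.*-distribˡ-+ (A r i) (x i) (y i))
                     (∑-distrib-+ (λ i → A r i ℤ.* x i) (λ i → A r i ℤ.* y i))

  *ᵛ-* : ∀ a x r → (A *ᵛ λ i → a ℤ.* x i) r ≡ a ℤ.* (A *ᵛ x) r
  *ᵛ-* a x r = trans (sum-cong-≗ λ i → swap (A r i) a (x i))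
                     (sym (*-distribˡ-sum a λ i → A r i ℤ.* x i))
    where
    swap : ∀ b c y → b ℤ.* (c ℤ.* y) ≡ c ℤ.* (b ℤ.* y)
    swap = solve-∀

  *ᵛ-∑ : ∀ {k} (a : Vector ℤ k) (z : Fin k → Vector ℤ n) r →
         (A *ᵛ λ i → ∑ᶻ λ l → a l ℤ.* z l i) r ≡ ∑ᶻ λ l → a l ℤ.* (A *ᵛ z l) r
  *ᵛ-∑ a z r = begin
    (∑ᶻ λ i → A r i ℤ.* ∑ᶻ λ l → a l ℤ.* z l i)
      ≡⟨ sum-cong-≗ (λ i → *-distribˡ-sum (A r i) λ l → a l ℤ.* z l i) ⟩
    (∑ᶻ λ i → ∑ᶻ λ l → A r i ℤ.* (a l ℤ.* z l i))
      ≡⟨ ∑-comm (λ i l → A r i ℤ.* (a l ℤ.* z l i)) ⟩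
    (∑ᶻ λ l → (A *ᵛ λ i → a l ℤ.* z l i) r)
      ≡⟨ sum-cong-≗ (λ l → *ᵛ-* (a l) (z l) r) ⟩
    (∑ᶻ λ l → a l ℤ.* (A *ᵛ z l) r) ∎
    where open ≡-Reasoning

-- Fraction-free Gaussian elimination: the unknown p is eliminated by means of
-- the equation a, and a solution of the remaining system is rescaled by the
-- pivot a p.
module _ {m n} (A : Fin m → Vector ℤ (suc n)) (a : Vector ℤ (suc n)) (p : Fin (suc n)) where

  eliminate : Fin m → Vector ℤ n
  eliminate r j = a p ℤ.* A r (punchIn p j) ℤ.- A r p ℤ.* a (punchIn p j)

  backSubstitute : Vector ℤ n → Vector ℤ (suc n)
  backSubstitute y = insertAt (λ j → a p ℤ.* y j) p (∑ᶻ λ j → ℤ.- a (punchIn p j) ℤ.* y j)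

  *ᵛ-backSubstitute : ∀ y r → (A *ᵛ backSubstitute y) r ≡ (eliminate *ᵛ y) r
  *ᵛ-backSubstitute y r = begin
    (A *ᵛ x) r
      ≡⟨ sum-remove {i = p} (λ i → A r i ℤ.* x i) ⟩
    A r p ℤ.* x p ℤ.+ (∑ᶻ λ j → A r (punchIn p j) ℤ.* x (punchIn p j))
      ≡⟨ cong₂ ℤ._+_ (cong (A r p ℤ.*_) (insertAt-lookup (λ j → a p ℤ.* y j) p _))
                     (sum-cong-≗ λ j → cong (A r (punchIn p j) ℤ.*_)
                       (insertAt-punchIn (λ j → a p ℤ.* y j) p _ j)) ⟩
    A r p ℤ.* (∑ᶻ λ j → ℤ.- a (punchIn p j) ℤ.* y j) ℤ.+ ∑ᶻ u
      ≡⟨ cong (ℤ._+ ∑ᶻ u) (*-distribˡ-sum (A r p) λ j → ℤ.- a (punchIn p j) ℤ.* y j) ⟩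
    (∑ᶻ λ j → A r p ℤ.* (ℤ.- a (punchIn p j) ℤ.* y j)) ℤ.+ ∑ᶻ u
      ≡⟨ ∑-distrib-+ (λ j → A r p ℤ.* (ℤ.- a (punchIn p j) ℤ.* y j)) u ⟨
    (∑ᶻ λ j → A r p ℤ.* (ℤ.- a (punchIn p j) ℤ.* y j) ℤ.+ u j)
      ≡⟨ sum-cong-≗ (λ j → collect (A r p) (a (punchIn p j)) (y j) (A r (punchIn p j)) (a p)) ⟩
    (eliminate *ᵛ y) r ∎
    where
    open ≡-Reasoning
    x = backSubstitute y
    u : Vector ℤ n
    u j = A r (punchIn p j) ℤ.* (a p ℤ.* y j)
    collect : ∀ b c y e f → b ℤ.* (ℤ.- c ℤ.* y) ℤ.+ e ℤ.* (f ℤ.* y) ≡ (f ℤ.* e ℤ.- b ℤ.* c) ℤ.* y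
    collect = solve-∀

-- Induction on the number of equations. A vanishing first row leaves an unknown to spare, so the
-- first unknown is set to zero. Otherwise back-substitution multiplies the smaller solution by a
-- nonzero pivot, and its nonzero entry survives.
nontrivialKernel : ∀ {m} (A : Fin m → Vector ℤ (suc m)) →
                   ∃[ x ] ((∃[ i ] x i ≢ 0ℤ) × (∀ r → (A *ᵛ x) r ≡ 0ℤ))
nontrivialKernel {zero}  A = (λ _ → 1ℤ) , (zero , λ ()) , λ ()
nontrivialKernel {suc m} A with all? (λ p → A zero p ℤₚ.≟ 0ℤ)
... | yes row₀≡0 =
  let y , (i , yᵢ≢0) , Ay≡0 = nontrivialKernel λ r j → A (suc r) (suc j)
  in 0ℤ ∷ y , (suc i , yᵢ≢0) , λ where
       zero    → ∑ᶻ-zero {z = λ i → A zero i ℤ.* (0ℤ ∷ y) i} λ i →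
                   trans (cong (ℤ._* (0ℤ ∷ y) i) (row₀≡0 i)) (ℤₚ.*-zeroˡ ((0ℤ ∷ y) i))
       (suc r) → trans (cong (ℤ._+ ((λ r j → A (suc r) (suc j)) *ᵛ y) r) (ℤₚ.*-zeroʳ (A (suc r) zero)))
                       (trans (ℤₚ.+-identityˡ _) (Ay≡0 r))
... | no row₀≢0 =
  let p , aₚ≢0 = ¬∀⟶∃¬ _ _ (λ p → A zero p ℤₚ.≟ 0ℤ) row₀≢0
      y , (i , yᵢ≢0) , Ay≡0 = nontrivialKernel (eliminate (A ∘ suc) (A zero) p)
      scaled = λ j → A zero p ℤ.* y j
      nonzero : A zero p ℤ.* y i ≢ 0ℤ
      nonzero ay≡0 = [ aₚ≢0 , yᵢ≢0 ] (ℤₚ.i*j≡0⇒i≡0∨j≡0 (A zero p) ay≡0)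
  in backSubstitute (A ∘ suc) (A zero) p y
   , (punchIn p i , λ eq → nonzero (trans (sym (insertAt-punchIn scaled p _ i)) eq))
   , λ where
       -- The pivot row, taken as a one-row system, is eliminated by itself and becomes zero.
       zero    → trans (*ᵛ-backSubstitute (λ (_ : Fin 1) → A zero) (A zero) p y zero)
                       (∑ᶻ-zero λ j → vanish (A zero p) (A zero (punchIn p j)) (y j))
       (suc r) → trans (*ᵛ-backSubstitute (A ∘ suc) (A zero) p y r) (Ay≡0 r)
  where
  vanish : ∀ a b y → (a ℤ.* b ℤ.- a ℤ.* b) ℤ.* y ≡ 0ℤ
  vanish = solve-∀

-- A kernel vector of the matrix (-b | A) whose first entry vanishes would
-- be a kernel vector of A.
rationalSolution : ∀ {n} (A : Fin n → Vector ℤ n) →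
  (∀ x → (∀ r → (A *ᵛ x) r ≡ 0ℤ) → ∀ i → x i ≡ 0ℤ) →
  ∀ (b : Vector ℤ n) → ∃[ y ] (NonZero y × ∃[ x ] (∀ r → (A *ᵛ x) r ≡ + y ℤ.* b r))
rationalSolution {n} A inj b with nontrivialKernel (λ r → (ℤ.- b r) ∷ A r)
... | w , (k , wₖ≢0) , Bw≡0 = positive (w zero) refl
  where
  x : Vector ℤ n
  x = w ∘ suc

  regroup : ∀ b y s → s ≡ (ℤ.- b ℤ.* y ℤ.+ s) ℤ.+ y ℤ.* b
  regroup = solve-∀

  Ax : ∀ r → (A *ᵛ x) r ≡ w zero ℤ.* b r
  Ax r = trans (regroup (b r) (w zero) ((A *ᵛ x) r))
               (trans (cong (ℤ._+ w zero ℤ.* b r) (Bw≡0 r)) (ℤₚ.+-identityˡ _))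

  w≡0 : w zero ≡ 0ℤ → ∀ i → w i ≡ 0ℤ
  w≡0 w₀≡0 zero    = w₀≡0
  w≡0 w₀≡0 (suc i) = inj x (λ r → trans (Ax r) (trans (cong (ℤ._* b r) w₀≡0) (ℤₚ.*-zeroˡ (b r)))) i

  positive : ∀ y → w zero ≡ y → ∃[ y ] (NonZero y × ∃[ x ] (∀ r → (A *ᵛ x) r ≡ + y ℤ.* b r))
  positive (+ zero)  eq = ⊥-elim (wₖ≢0 (w≡0 eq k))
  positive (+ suc y) eq = suc y , _ , x , λ r → trans (Ax r) (cong (ℤ._* b r) eq)
  -- The denominator has to be a natural number, so a negative one changes sign together with x.
  positive -[1+ y ]  eq = suc y , _ , (λ i → ℤ.-1ℤ ℤ.* x i) , λ r →
    trans (*ᵛ-* A ℤ.-1ℤ x r)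
      (trans (cong (ℤ.-1ℤ ℤ.*_) (trans (Ax r) (cong (ℤ._* b r) eq)))
             (negate (+ suc y) (b r)))
    where
    negate : ∀ u b → ℤ.-1ℤ ℤ.* (ℤ.- u ℤ.* b) ≡ u ℤ.* b
    negate = solve-∀

-- Rationals and null sequences

∑ℚ : ∀ {n} → Vector ℚ n → ℚ
∑ℚ = ℚ-Sum.sum

-- `k ℚ./ 1` is stuck on a variable `k`; the explicit form in lowest terms lets numerators be read
-- off and arithmetic compute.
ℤ→ℚ-mkℚ : ∀ k → ℤ→ℚ k ≡ mkℚ k 0 (Coprimality.sym (Coprimality.1-coprimeTo ℤ.∣ k ∣))
ℤ→ℚ-mkℚ k = ℚₚ.↥p/↧p≡p (mkℚ k 0 (Coprimality.sym (Coprimality.1-coprimeTo ℤ.∣ k ∣)))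

ℤ→ℚ-injective : ∀ {k l} → ℤ→ℚ k ≡ ℤ→ℚ l → k ≡ l
ℤ→ℚ-injective {k} {l} eq = cong ↥_ (trans (sym (ℤ→ℚ-mkℚ k)) (trans eq (ℤ→ℚ-mkℚ l)))

ℤ→ℚ-+ : ∀ k l → ℤ→ℚ (k ℤ.+ l) ≡ ℤ→ℚ k ℚ.+ ℤ→ℚ l
ℤ→ℚ-+ k l = sym (trans (cong₂ ℚ._+_ (ℤ→ℚ-mkℚ k) (ℤ→ℚ-mkℚ l))
  (cong ℤ→ℚ (cong₂ ℤ._+_ (ℤₚ.*-identityʳ k) (ℤₚ.*-identityʳ l))))

ℤ→ℚ-* : ∀ k l → ℤ→ℚ (k ℤ.* l) ≡ ℤ→ℚ k ℚ.* ℤ→ℚ l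
ℤ→ℚ-* k l = sym (cong₂ ℚ._*_ (ℤ→ℚ-mkℚ k) (ℤ→ℚ-mkℚ l))

ℤ→ℚ-neg : ∀ k → ℤ→ℚ (ℤ.- k) ≡ ℚ.- ℤ→ℚ k
ℤ→ℚ-neg k = begin
  ℤ→ℚ (ℤ.- k)                  ≡⟨ cong ℤ→ℚ (sym (ℤₚ.-1*i≡-i k)) ⟩
  ℤ→ℚ (ℤ.-1ℤ ℤ.* k)            ≡⟨ ℤ→ℚ-* ℤ.-1ℤ k ⟩
  ℚ.- 1ℚ ℚ.* ℤ→ℚ k             ≡⟨ ℚₚ.neg-distribˡ-* 1ℚ (ℤ→ℚ k) ⟨
  ℚ.- (1ℚ ℚ.* ℤ→ℚ k)           ≡⟨ cong ℚ.-_ (ℚₚ.*-identityˡ (ℤ→ℚ k)) ⟩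
  ℚ.- ℤ→ℚ k                    ∎
  where open ≡-Reasoning

ℤ→ℚ-∑ : ∀ {n} (z : Vector ℤ n) → ℤ→ℚ (∑ᶻ z) ≡ ∑ℚ (ℤ→ℚ ∘ z)
ℤ→ℚ-∑ {zero}  z = refl
ℤ→ℚ-∑ {suc n} z = trans (ℤ→ℚ-+ (z zero) (∑ᶻ (z ∘ suc))) (cong (ℤ→ℚ (z zero) ℚ.+_) (ℤ→ℚ-∑ (z ∘ suc)))

ℤ→ℚ-pos : ∀ n .{{_ : NonZero n}} → ℚ.Positive (ℤ→ℚ (+ n))
ℤ→ℚ-pos n = ℚₚ.normalize-pos n 1

ℤ→ℚ-mono-< : ∀ {k l} → k ℤ.< l → ℤ→ℚ k ℚ.< ℤ→ℚ l
ℤ→ℚ-mono-< {k} {l} k<l = subst₂ ℚ._<_ (sym (ℤ→ℚ-mkℚ k)) (sym (ℤ→ℚ-mkℚ l))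
  (ℚ.*<* (subst₂ ℤ._<_ (sym (ℤₚ.*-identityʳ k)) (sym (ℤₚ.*-identityʳ l)) k<l))

ℤ→ℚ-nonNeg⇒natural : ∀ k → 0ℚ ℚ.≤ ℤ→ℚ k → ∃[ n ] k ≡ + n
ℤ→ℚ-nonNeg⇒natural (+ n)    _   = n , refl
ℤ→ℚ-nonNeg⇒natural -[1+ n ] 0≤k =
  ⊥-elim (ℚₚ.<-irrefl refl (ℚₚ.≤-<-trans 0≤k (ℤ→ℚ-mono-< { -[1+ n ]} {0ℤ} ℤ.-<+)))

p-q≡0⇒p≡q : ∀ p q → p ℚ.- q ≡ 0ℚ → p ≡ q
p-q≡0⇒p≡q p q p-q≡0 = trans (restore p q) (trans (cong (ℚ._+ q) p-q≡0) (ℚₚ.+-identityˡ q))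
  where
  open +-*-Solver
  restore : ∀ p q → p ≡ (p ℚ.- q) ℚ.+ q
  restore = solve 2 (λ p q → p := (p :- q) :+ q) refl

/-*-denominator : ∀ k n .{{_ : NonZero n}} → (k ℚ./ n) ℚ.* ℤ→ℚ (+ n) ≡ ℤ→ℚ k
/-*-denominator k n@(suc m) = ℚₚ.toℚᵘ-injective (begin-equality
  toℚᵘ ((k ℚ./ n) ℚ.* ℤ→ℚ (+ n))            ≃⟨ ℚₚ.toℚᵘ-homo-* (k ℚ./ n) (ℤ→ℚ (+ n)) ⟩
  toℚᵘ (k ℚ./ n) ℚᵘ.* toℚᵘ (ℤ→ℚ (+ n))      ≃⟨ ℚᵘₚ.*-cong (ℚₚ.toℚᵘ-fromℚᵘ (ℚᵘ.mkℚᵘ k m)) (ℚₚ.toℚᵘ-fromℚᵘ (ℚᵘ.mkℚᵘ (+ n) 0)) ⟩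
  ℚᵘ.mkℚᵘ k m ℚᵘ.* ℚᵘ.mkℚᵘ (+ n) 0          ≃⟨ ℚᵘ.*≡* (trans (ℤₚ.*-identityʳ (k ℤ.* + n))
                                                 (cong (k ℤ.*_) (cong +_ (sym (ℕₚ.*-identityʳ n))))) ⟩
  ℚᵘ.mkℚᵘ k 0                               ≃⟨ ℚₚ.toℚᵘ-fromℚᵘ (ℚᵘ.mkℚᵘ k 0) ⟨
  toℚᵘ (ℤ→ℚ k)                              ∎)
  where open ℚᵘₚ.≤-Reasoning

*-ℤ→ℚ-cancelʳ : ∀ n .{{_ : NonZero n}} {p q} → p ℚ.* ℤ→ℚ (+ n) ≡ q ℚ.* ℤ→ℚ (+ n) → p ≡ q
*-ℤ→ℚ-cancelʳ n eq = ℚₚ.≤-antisym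
  (ℚₚ.*-cancelʳ-≤-pos (ℤ→ℚ (+ n)) {{ℤ→ℚ-pos n}} (ℚₚ.≤-reflexive eq))
  (ℚₚ.*-cancelʳ-≤-pos (ℤ→ℚ (+ n)) {{ℤ→ℚ-pos n}} (ℚₚ.≤-reflexive (sym eq)))

/-<1 : ∀ {m} n .{{_ : NonZero n}} → m ℕ.< n → (+ m ℚ./ n) ℚ.< 1ℚ
/-<1 {m} n m<n = ℚₚ.*-cancelʳ-<-nonNeg (ℤ→ℚ (+ n)) {{ℚₚ.pos⇒nonNeg (ℤ→ℚ (+ n)) {{ℤ→ℚ-pos n}}}}
  (subst₂ ℚ._<_ (sym (/-*-denominator (+ m) n)) (sym (ℚₚ.*-identityˡ (ℤ→ℚ (+ n))))
    (ℤ→ℚ-mono-< (ℤ.+<+ m<n)))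

/-nonNeg : ∀ m n .{{_ : NonZero n}} → 0ℚ ℚ.≤ (+ m ℚ./ n)
/-nonNeg m n = ℚₚ.nonNegative⁻¹ (+ m ℚ./ n) {{ℚₚ.normalize-nonNeg m n}}

-- x ≃ y unfolds to Null (λ n → seq x n ℚ.- seq y n).
Null : (ℕ → ℚ) → Set
Null s = ∀ ε → 0ℚ ℚ.< ε → ∃[ K ] (∀ n → K ℕ.≤ n → ∣ s n ∣ ℚ.< ε)

½*-pos : ∀ {ε} → 0ℚ ℚ.< ε → 0ℚ ℚ.< ½ ℚ.* ε
½*-pos {ε} 0<ε = subst (ℚ._< ½ ℚ.* ε) (ℚₚ.*-zeroʳ ½) (ℚₚ.*-monoʳ-<-pos ½ 0<ε)

½*+½* : ∀ ε → ½ ℚ.* ε ℚ.+ ½ ℚ.* ε ≡ ε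
½*+½* ε = trans (sym (ℚₚ.*-distribʳ-+ ε ½ ½)) (ℚₚ.*-identityˡ ε)

Null-resp : ∀ {s t} → (∀ n → s n ≡ t n) → Null s → Null t
Null-resp s≗t s→0 ε 0<ε =
  let K , s<ε = s→0 ε 0<ε in K , λ n K≤n → subst (λ q → ∣ q ∣ ℚ.< ε) (s≗t n) (s<ε n K≤n)

Null-0 : ∀ {s} → (∀ n → s n ≡ 0ℚ) → Null s
Null-0 s≡0 = Null-resp (sym ∘ s≡0) λ ε 0<ε → 0 , λ _ _ → 0<ε

Null-+ : ∀ {s t} → Null s → Null t → Null (λ n → s n ℚ.+ t n)
Null-+ {s} {t} s→0 t→0 ε 0<ε =
  let K , s<ε = s→0 (½ ℚ.* ε) (½*-pos 0<ε)
      L , t<ε = t→0 (½ ℚ.* ε) (½*-pos 0<ε)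
  in K ℕ.⊔ L , λ n K⊔L≤n →
     ℚₚ.≤-<-trans (ℚₚ.∣p+q∣≤∣p∣+∣q∣ (s n) (t n))
       (subst (∣ s n ∣ ℚ.+ ∣ t n ∣ ℚ.<_) (½*+½* ε)
         (ℚₚ.+-mono-< (s<ε n (ℕₚ.m⊔n≤o⇒m≤o K L K⊔L≤n)) (t<ε n (ℕₚ.m⊔n≤o⇒n≤o K L K⊔L≤n))))

divide-pos : ∀ q .{{_ : ℚ.Positive q}} {ε} → 0ℚ ℚ.< ε → ∃[ δ ] (0ℚ ℚ.< δ × q ℚ.* δ ≡ ε)
divide-pos q {ε} 0<ε = δ
  , subst (ℚ._< δ) (ℚₚ.*-zeroʳ (ℚ.1/ q)) (ℚₚ.*-monoʳ-<-pos (ℚ.1/ q) {{ℚₚ.1/pos⇒pos q}} 0<ε)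
  , trans (sym (ℚₚ.*-assoc q (ℚ.1/ q) ε)) (trans (cong (ℚ._* ε) (ℚₚ.*-inverseʳ q)) (ℚₚ.*-identityˡ ε))
  where
  instance
    q≢0 : ℚ.NonZero q
    q≢0 = ℚₚ.pos⇒nonZero q
  δ = ℚ.1/ q ℚ.* ε

Null-* : ∀ q .{{_ : ℚ.Positive q}} {s} → Null s → Null (λ n → q ℚ.* s n)
Null-* q {s} s→0 ε 0<ε =
  let δ , 0<δ , qδ≡ε = divide-pos q 0<ε
      K , s<δ = s→0 δ 0<δ
  in K , λ n K≤n → subst₂ ℚ._<_ (abs-* n) qδ≡ε (ℚₚ.*-monoʳ-<-pos q (s<δ n K≤n))
  where
  abs-* : ∀ n → q ℚ.* ∣ s n ∣ ≡ ∣ q ℚ.* s n ∣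
  abs-* n = sym (trans (ℚₚ.∣p*q∣≡∣p∣*∣q∣ q (s n))
                       (cong (ℚ._* ∣ s n ∣) (ℚₚ.0≤p⇒∣p∣≡p (ℚₚ.<⇒≤ (ℚₚ.positive⁻¹ q)))))

Null-swap : ∀ {s t : ℕ → ℚ} → Null (λ n → s n ℚ.- t n) → Null (λ n → t n ℚ.- s n)
Null-swap {s} {t} s-t→0 ε 0<ε =
  let K , s-t<ε = s-t→0 ε 0<ε
  in K , λ n K≤n → subst (ℚ._< ε) (trans (sym (ℚₚ.∣-p∣≡∣p∣ (s n ℚ.- t n))) (cong ∣_∣ (negate (s n) (t n)))) (s-t<ε n K≤n)
  where
  open +-*-Solver
  negate : ∀ p q → ℚ.- (p ℚ.- q) ≡ q ℚ.- p
  negate = solve 2 (λ p q → :- (p :- q) := q :- p) refl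

Null-trans : ∀ {s t u : ℕ → ℚ} → Null (λ n → s n ℚ.- t n) → Null (λ n → t n ℚ.- u n) → Null (λ n → s n ℚ.- u n)
Null-trans {s} {t} {u} s-t→0 t-u→0 = Null-resp (λ n → telescope (s n) (t n) (u n)) (Null-+ s-t→0 t-u→0)
  where
  open +-*-Solver
  telescope : ∀ p q r → (p ℚ.- q) ℚ.+ (q ℚ.- r) ≡ p ℚ.- r
  telescope = solve 3 (λ p q r → (p :- q) :+ (q :- r) := p :- r) refl

-- The way back from limits to exact equalities: a nonzero q violates the bound for ε = ∣q∣.
Null-const : ∀ {q} → Null (λ _ → q) → q ≡ 0ℚ
Null-const {q} q→0 with ℚₚ.<-cmp 0ℚ ∣ q ∣
... | tri< 0<∣q∣ _ _ = let K , ∣q∣<∣q∣ = q→0 ∣ q ∣ 0<∣q∣ in ⊥-elim (ℚₚ.<-irrefl refl (∣q∣<∣q∣ K ℕₚ.≤-refl))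
... | tri≈ _ 0≡∣q∣ _ = ℚₚ.∣p∣≡0⇒p≡0 q (sym 0≡∣q∣)
... | tri> _ _ ∣q∣<0 = ⊥-elim (ℚₚ.<-irrefl refl (ℚₚ.≤-<-trans (ℚₚ.0≤∣p∣ q) ∣q∣<0))

p≤∣p∣ : ∀ p → p ℚ.≤ ∣ p ∣
p≤∣p∣ p with ℚₚ.≤-total 0ℚ p
... | inj₁ 0≤p = ℚₚ.≤-reflexive (sym (ℚₚ.0≤p⇒∣p∣≡p 0≤p))
... | inj₂ p≤0 = ℚₚ.≤-trans p≤0 (ℚₚ.0≤∣p∣ p)

·-nonNeg : ∀ q .{{_ : ℚ.Positive q}} {x} → fromℚ 0ℚ ≤ᴿ x → fromℚ 0ℚ ≤ᴿ (q · x)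
·-nonNeg q {x} 0≤x ε 0<ε =
  let δ , 0<δ , qδ≡ε = divide-pos q 0<ε
      K , 0<x+δ = 0≤x δ 0<δ
  in K , λ n K≤n → subst₂ ℚ._<_ (ℚₚ.*-zeroʳ q)
       (trans (ℚₚ.*-distribˡ-+ q (seq x n) δ) (cong (λ e → q ℚ.* seq x n ℚ.+ e) qδ≡ε))
       (ℚₚ.*-monoʳ-<-pos q (0<x+δ n K≤n))

-- For negative q and ε = -q/2, the terms would eventually lie both above and below q/2.
limit-nonNeg : ∀ {x q} → fromℚ 0ℚ ≤ᴿ x → Null (λ n → seq x n ℚ.- q) → 0ℚ ℚ.≤ q
limit-nonNeg {x} {q} 0≤x x→q = ℚₚ.≮⇒≥ λ q<0 →
  let ε      = ½ ℚ.* (ℚ.- q)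
      0<ε    = ½*-pos (ℚₚ.neg-antimono-< q<0)
      K , 0< = 0≤x ε 0<ε
      L , <ε = x→q ε 0<ε
      n      = K ℕ.⊔ L
      x-q<ε  = ℚₚ.≤-<-trans (p≤∣p∣ (seq x n ℚ.- q)) (<ε n (ℕₚ.m≤n⊔m K L))
  in ℚₚ.<-irrefl refl (subst₂ ℚ._<_ (ℚₚ.+-identityˡ (seq x n ℚ.- q)) (sum-eq (seq x n) q)
       (ℚₚ.<-trans (ℚₚ.+-mono-<-≤ (0< n (ℕₚ.m≤m⊔n K L)) ℚₚ.≤-refl)
                   (ℚₚ.+-monoʳ-< (seq x n ℚ.+ ε) x-q<ε)))
  where
  sum-eq : ∀ s q → (s ℚ.+ ½ ℚ.* (ℚ.- q)) ℚ.+ ½ ℚ.* (ℚ.- q) ≡ s ℚ.- q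
  sum-eq s q = trans (ℚₚ.+-assoc s _ _) (cong (s ℚ.+_) (½*+½* (ℚ.- q)))

fromℚ-nonNeg : ∀ {q} → 0ℚ ℚ.≤ q → fromℚ 0ℚ ≤ᴿ fromℚ q
fromℚ-nonNeg {q} 0≤q ε 0<ε = 0 , λ _ _ → ℚₚ.+-mono-≤-< 0≤q 0<ε

fromℚ-<1 : ∀ {q} → q ℚ.< 1ℚ → fromℚ q <ᴿ fromℚ 1ℚ
fromℚ-<1 {q} q<1 =
  -- `_<ᴿ_` asks for q + ε strictly below 1, so ε = 1 - q is too large and an intermediate rational
  -- supplies the gap.
  let m , q<m , m<1 = ℚₚ.<-dense q<1
  in m ℚ.- q
   , subst (ℚ._< m ℚ.- q) (ℚₚ.+-inverseʳ q) (ℚₚ.+-monoˡ-< (ℚ.- q) q<m)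
   , 0 , λ _ _ → subst (ℚ._< 1ℚ) (sym (cancel q m)) m<1
  where
  open +-*-Solver
  cancel : ∀ q m → q ℚ.+ (m ℚ.- q) ≡ m
  cancel = solve 2 (λ q m → q :+ (m :- q) := m) refl

seq-∑ᴿ : ∀ {k} (t : Vector ℝ k) n → seq (∑ᴿ t) n ≡ ∑ℚ λ i → seq (t i) n
seq-∑ᴿ {zero}  t n = refl
seq-∑ᴿ {suc k} t n = cong (seq (t zero) n ℚ.+_) (seq-∑ᴿ (t ∘ suc) n)

-- Integer vectors representing lattice points and codewords

module Homogenised {d} (Δ : LatticeSimplex d) where

  -- Column i is (vᵢ , 1), with the level coordinate placed first.
  A : Fin (suc d) → Vector ℤ (suc d)
  A zero    i = 1ℤ
  A (suc j) i = vertex Δ i j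

  ∑A : Vector ℚ (suc d) → Vector ℚ (suc d)
  ∑A q r = ∑ℚ λ i → ℤ→ℚ (A r i) ℚ.* q i

  ∑A-zero : ∀ q → ∑A q zero ≡ ∑ℚ q
  ∑A-zero q = ℚ-Sum.sum-cong-≗ λ i → ℚₚ.*-identityˡ (q i)

  ∑A-ℤ→ℚ : ∀ z r → ∑A (ℤ→ℚ ∘ z) r ≡ ℤ→ℚ ((A *ᵛ z) r)
  ∑A-ℤ→ℚ z r = sym (trans (ℤ→ℚ-∑ λ i → A r i ℤ.* z i) (ℚ-Sum.sum-cong-≗ λ i → ℤ→ℚ-* (A r i) (z i)))

  ∑A-+ : ∀ p q r → ∑A (λ i → p i ℚ.+ q i) r ≡ ∑A p r ℚ.+ ∑A q r
  ∑A-+ p q r = trans (ℚ-Sum.sum-cong-≗ λ i → ℚₚ.*-distribˡ-+ (ℤ→ℚ (A r i)) (p i) (q i))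
    (ℚ-Sum.∑-distrib-+ (λ i → ℤ→ℚ (A r i) ℚ.* p i) (λ i → ℤ→ℚ (A r i) ℚ.* q i))

  ∑A-* : ∀ a q r → ∑A (λ i → a ℚ.* q i) r ≡ a ℚ.* ∑A q r
  ∑A-* a q r = trans (ℚ-Sum.sum-cong-≗ λ i → swap (ℤ→ℚ (A r i)) a (q i))
    (sym (ℚ-Sum.*-distribˡ-sum a λ i → ℤ→ℚ (A r i) ℚ.* q i))
    where
    open +-*-Solver
    swap : ∀ b c y → b ℚ.* (c ℚ.* y) ≡ c ℚ.* (b ℚ.* y)
    swap = solve 3 (λ b c y → b :* (c :* y) := c :* (b :* y)) refl

  -- The real system A t = Q, with the level and the coordinates as rows of one matrix. Stated
  -- through the n-th terms, it is manipulated entirely inside ℚ.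
  Solves : Vector ℝ (suc d) → Vector ℤ (suc d) → Set
  Solves t Q = ∀ r → Null λ n → ∑A (λ i → seq (t i) n) r ℚ.- ℤ→ℚ (Q r)

  solves : ∀ t Q → ∑ᴿ t ≃ fromℤ (Q zero) →
           (∀ j → comb t (vertex Δ) j ≃ fromℤ (Q (suc j))) → Solves t Q
  solves t Q level _     zero    = Null-resp (λ n → cong (ℚ._- ℤ→ℚ (Q zero))
    (trans (seq-∑ᴿ t n) (sym (∑A-zero λ i → seq (t i) n)))) level
  solves t Q _     point (suc j) = Null-resp
    (λ n → cong (ℚ._- ℤ→ℚ (Q (suc j))) (seq-∑ᴿ (λ i → ℤ→ℚ (vertex Δ i j) · t i) n)) (point j)

  solves⇒level : ∀ t Q → Solves t Q → ∑ᴿ t ≃ fromℤ (Q zero)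
  solves⇒level t Q At≃Q = Null-resp (λ n → cong (ℚ._- ℤ→ℚ (Q zero))
    (trans (∑A-zero λ i → seq (t i) n) (sym (seq-∑ᴿ t n)))) (At≃Q zero)

  solves⇒point : ∀ t Q → Solves t Q → ∀ j → comb t (vertex Δ) j ≃ fromℤ (Q (suc j))
  solves⇒point t Q At≃Q j = Null-resp (λ n → cong (ℚ._- ℤ→ℚ (Q (suc j)))
    (sym (seq-∑ᴿ (λ i → ℤ→ℚ (vertex Δ i j) · t i) n))) (At≃Q (suc j))

  solves-0 : ∀ t → Solves t (λ _ → 0ℤ) → ∀ i → t i ≃ fromℚ 0ℚ
  solves-0 t At≃0 = affinelyIndependent Δ t (solves⇒level t (λ _ → 0ℤ) At≃0) (solves⇒point t (λ _ → 0ℤ) At≃0)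

  -- An integer kernel vector is a constant real solution, hence tends to zero by affine
  -- independence, and a constant null sequence is zero.
  A-injective₀ : ∀ x → (∀ r → (A *ᵛ x) r ≡ 0ℤ) → ∀ i → x i ≡ 0ℤ
  A-injective₀ x Ax≡0 i = ℤ→ℚ-injective (trans (sym (ℚₚ.+-identityʳ _))
    (Null-const (solves-0 (fromℤ ∘ x) (λ r → Null-0 λ _ →
      cong (ℚ._- 0ℚ) (trans (∑A-ℤ→ℚ x r) (cong ℤ→ℚ (Ax≡0 r)))) i)))

  A-injective : ∀ x y → (∀ r → (A *ᵛ x) r ≡ (A *ᵛ y) r) → ∀ i → x i ≡ y i
  A-injective x y Ax≡Ay i = ℤₚ.i-j≡0⇒i≡j (x i) (y i)
    (trans (cong (λ k → x i ℤ.+ k) (sym (ℤₚ.-1*i≡-i (y i)))) (A-injective₀ (λ i → x i ℤ.+ ℤ.-1ℤ ℤ.* y i) (λ r →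
      trans (*ᵛ-+ A x (λ i → ℤ.-1ℤ ℤ.* y i) r)
        (trans (cong₂ ℤ._+_ (Ax≡Ay r) (*ᵛ-* A ℤ.-1ℤ y r)) (cancel ((A *ᵛ y) r)))) i))
    where
    cancel : ∀ a → a ℤ.+ ℤ.-1ℤ ℤ.* a ≡ 0ℤ
    cancel = solve-∀

  module _ (N : ℕ) .{{_ : NonZero N}} where

    -- The equation z = N A⁻¹ Q without division: the entries of z / N are the barycentric
    -- coordinates of Q.
    Scaled : Vector ℤ (suc d) → Vector ℤ (suc d) → Set
    Scaled z Q = ∀ r → (A *ᵛ z) r ≡ + N ℤ.* Q r

    scaled⇒solves : ∀ z Q → Scaled z Q → Solves (λ i → fromℚ (z i ℚ./ N)) Q
    scaled⇒solves z Q Az≡NQ r = Null-0 λ _ →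
      trans (cong (ℚ._- ℤ→ℚ (Q r)) (*-ℤ→ℚ-cancelʳ N {∑A (λ i → z i ℚ./ N) r} {ℤ→ℚ (Q r)} (begin
        ∑A (λ i → z i ℚ./ N) r ℚ.* ν              ≡⟨ ℚₚ.*-comm _ ν ⟩
        ν ℚ.* ∑A (λ i → z i ℚ./ N) r              ≡⟨ ∑A-* ν (λ i → z i ℚ./ N) r ⟨
        ∑A (λ i → ν ℚ.* (z i ℚ./ N)) r            ≡⟨ ℚ-Sum.sum-cong-≗ (λ i → cong (ℤ→ℚ (A r i) ℚ.*_)
                                                      (trans (ℚₚ.*-comm ν (z i ℚ./ N)) (/-*-denominator (z i) N))) ⟩
        ∑A (ℤ→ℚ ∘ z) r                            ≡⟨ ∑A-ℤ→ℚ z r ⟩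
        ℤ→ℚ ((A *ᵛ z) r)                          ≡⟨ cong ℤ→ℚ (Az≡NQ r) ⟩
        ℤ→ℚ (+ N ℤ.* Q r)                         ≡⟨ ℤ→ℚ-* (+ N) (Q r) ⟩
        ν ℚ.* ℤ→ℚ (Q r)                           ≡⟨ ℚₚ.*-comm ν _ ⟩
        ℤ→ℚ (Q r) ℚ.* ν                           ∎))) (ℚₚ.+-inverseʳ (ℤ→ℚ (Q r)))
      where
      open ≡-Reasoning
      ν = ℤ→ℚ (+ N)

    -- N t and z have the same image under A, so affine independence applies
    -- to N t - z.
    solves⇒scaled : ∀ t z Q → Solves t Q → Scaled z Q →
                    ∀ i → Null λ n → ℤ→ℚ (+ N) ℚ.* seq (t i) n ℚ.- ℤ→ℚ (z i)
    solves⇒scaled t z Q At≃Q Az≡NQ i = Null-resp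
      (λ n → trans (ℚₚ.+-identityʳ _) (cong (ν ℚ.* seq (t i) n ℚ.+_)
        (trans (cong ℤ→ℚ (ℤₚ.-1*i≡-i (z i))) (ℤ→ℚ-neg (z i)))))
      (solves-0 u Au≃0 i)
      where
      open ≡-Reasoning
      ν = ℤ→ℚ (+ N)

      u : Vector ℝ (suc d)
      u i = (ν · t i) +ᴿ fromℤ (ℤ.-1ℤ ℤ.* z i)

      factor : ∀ a b c → a ℚ.* (b ℚ.- c) ≡ (a ℚ.* b ℚ.+ (ℚ.- 1ℚ) ℚ.* (a ℚ.* c)) ℚ.- 0ℚ
      factor = solve 3 (λ a b c → a :* (b :- c) := (a :* b :+ (:- con 1ℚ) :* (a :* c)) :- con 0ℚ) refl
        where open +-*-Solver

      Au≃0 : Solves u (λ _ → 0ℤ)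
      Au≃0 r = Null-resp (λ n → let s = λ i → seq (t i) n in begin
        ν ℚ.* (∑A s r ℚ.- ℤ→ℚ (Q r))
          ≡⟨ factor ν (∑A s r) (ℤ→ℚ (Q r)) ⟩
        (ν ℚ.* ∑A s r ℚ.+ (ℚ.- 1ℚ) ℚ.* (ν ℚ.* ℤ→ℚ (Q r))) ℚ.- 0ℚ
          ≡⟨ cong (ℚ._- 0ℚ) (cong₂ ℚ._+_ (∑A-* ν s r) (Az r)) ⟨
        (∑A (λ i → ν ℚ.* s i) r ℚ.+ ∑A (λ i → ℤ→ℚ (ℤ.-1ℤ ℤ.* z i)) r) ℚ.- 0ℚ
          ≡⟨ cong (ℚ._- 0ℚ) (∑A-+ (λ i → ν ℚ.* s i) (λ i → ℤ→ℚ (ℤ.-1ℤ ℤ.* z i)) r) ⟨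
        ∑A (λ i → seq (u i) n) r ℚ.- 0ℚ ∎) (Null-* ν {{ℤ→ℚ-pos N}} (At≃Q r))
        where
        Az : ∀ r → ∑A (λ i → ℤ→ℚ (ℤ.-1ℤ ℤ.* z i)) r ≡ (ℚ.- 1ℚ) ℚ.* (ν ℚ.* ℤ→ℚ (Q r))
        Az r = begin
          ∑A (λ i → ℤ→ℚ (ℤ.-1ℤ ℤ.* z i)) r          ≡⟨ ∑A-ℤ→ℚ (λ i → ℤ.-1ℤ ℤ.* z i) r ⟩
          ℤ→ℚ ((A *ᵛ λ i → ℤ.-1ℤ ℤ.* z i) r)        ≡⟨ cong ℤ→ℚ (*ᵛ-* A ℤ.-1ℤ z r) ⟩
          ℤ→ℚ (ℤ.-1ℤ ℤ.* (A *ᵛ z) r)                ≡⟨ cong (λ k → ℤ→ℚ (ℤ.-1ℤ ℤ.* k)) (Az≡NQ r) ⟩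
          ℤ→ℚ (ℤ.-1ℤ ℤ.* (+ N ℤ.* Q r))             ≡⟨ ℤ→ℚ-* ℤ.-1ℤ (+ N ℤ.* Q r) ⟩
          (ℚ.- 1ℚ) ℚ.* ℤ→ℚ (+ N ℤ.* Q r)            ≡⟨ cong ((ℚ.- 1ℚ) ℚ.*_) (ℤ→ℚ-* (+ N) (Q r)) ⟩
          (ℚ.- 1ℚ) ℚ.* (ν ℚ.* ℤ→ℚ (Q r))            ∎

    -- The bound makes every n i / N its own fractional part, with integer part 0.
    scaled⇒∈Λ : ∀ (n : Vector ℕ (suc d)) Q → (∀ i → n i ℕ.< N) → Scaled (+_ ∘ n) Q →
                (λ i → fromℚ (+ n i ℚ./ N)) ∈Λ Δ
    scaled⇒∈Λ n Q n<N An≡NQ = record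
      { frac             = λ i → fromℚ (+ n i ℚ./ N)
      ; isFractionalPart = λ i → fromℚ-nonNeg (/-nonNeg (n i) N) , fromℚ-<1 (/-<1 N (n<N i)) , 0ℤ ,
          Null-0 λ _ → trans (cong (λ q → (+ n i ℚ./ N) ℚ.- q) (ℚₚ.+-identityˡ (+ n i ℚ./ N)))
                             (ℚₚ.+-inverseʳ (+ n i ℚ./ N))
      ; point            = Q ∘ suc
      ; level            = Q zero
      ; point-eq         = solves⇒point (λ i → fromℚ (+ n i ℚ./ N)) Q (scaled⇒solves (+_ ∘ n) Q An≡NQ)
      ; level-eq         = solves⇒level (λ i → fromℚ (+ n i ℚ./ N)) Q (scaled⇒solves (+_ ∘ n) Q An≡NQ)
      }

  -- Integrality of N A⁻¹, and passage between real data and integer vectors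

  module _ {N : ℕ} .{{_ : NonZero N}} (isN : IsN Δ N) where

    -- Clearing the denominators of A⁻¹ Q takes no more than the factor N,
    -- since its fractional part represents an element of Λ.
    clearDenominator : ∀ y .{{_ : NonZero y}} x Q → Scaled y x Q → ∃[ z ] Scaled N z Q
    clearDenominator y x Q Ax≡yQ = z , λ r →
      ℤₚ.*-cancelˡ-≡ (+ y) ((A *ᵛ z) r) (+ N ℤ.* Q r) {{ℤ.≢-nonZero (ℕ.≢-nonZero⁻¹ y ∘ ℤₚ.+-injective)}} (yAz r)
      where
      open ≡-Reasoning
      -- Since x = ρ + y k, the quotient ρ / y is the fractional part of x / y and k its integer
      -- part.
      ρ : Vector ℕ (suc d)
      ρ i = x i ℤ-DivMod.%ℕ y

      k : Vector ℤ (suc d)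
      k i = x i ℤ-DivMod./ℕ y

      -- Dropping the integer parts k moves the lattice point by A k.
      Q′ : Vector ℤ (suc d)
      Q′ r = Q r ℤ.+ ℤ.-1ℤ ℤ.* (A *ᵛ k) r

      Aρ : Scaled y (+_ ∘ ρ) Q′
      Aρ r = begin
        (A *ᵛ (+_ ∘ ρ)) r
          ≡⟨ *ᵛ-cong A (λ i → trans (isolate (+ ρ i) (k i) (+ y))
               (cong (ℤ._+ ℤ.- + y ℤ.* k i) (sym (ℤ-DivMod.a≡a%ℕn+[a/ℕn]*n (x i) y)))) r ⟩
        (A *ᵛ λ i → x i ℤ.+ ℤ.- + y ℤ.* k i) r
          ≡⟨ *ᵛ-+ A x (λ i → ℤ.- + y ℤ.* k i) r ⟩
        (A *ᵛ x) r ℤ.+ (A *ᵛ λ i → ℤ.- + y ℤ.* k i) r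
          ≡⟨ cong₂ ℤ._+_ (Ax≡yQ r) (*ᵛ-* A (ℤ.- + y) k r) ⟩
        + y ℤ.* Q r ℤ.+ ℤ.- + y ℤ.* (A *ᵛ k) r
          ≡⟨ collect (+ y) (Q r) ((A *ᵛ k) r) ⟩
        + y ℤ.* (Q r ℤ.+ ℤ.-1ℤ ℤ.* (A *ᵛ k) r) ∎
        where
        isolate : ∀ a b c → a ≡ (a ℤ.+ b ℤ.* c) ℤ.+ ℤ.- c ℤ.* b
        isolate = solve-∀
        collect : ∀ c q a → c ℤ.* q ℤ.+ ℤ.- c ℤ.* a ≡ c ℤ.* (q ℤ.+ ℤ.-1ℤ ℤ.* a)
        collect = solve-∀

      f : Vector ℚ (suc d)
      f i = + ρ i ℚ./ y

      ↧f∣N : ∀ i → ↧ₙ f i ∣ N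
      ↧f∣N i = IsLCM.commonMultiple isN
        ((λ i → fromℚ (f i)) , scaled⇒∈Λ y ρ Q′ (λ i → ℤ-DivMod.n%ℕd<d (x i) y) Aρ
          , i , f i , Null-0 (λ _ → ℚₚ.+-inverseʳ (f i)) , refl)

      -- The integer N ρ / y: the reduced denominator of `f i` divides N, and the cofactor
      -- multiplies the numerator.
      w : Vector ℤ (suc d)
      w i = + quotient (↧f∣N i) ℤ.* ↥ f i

      yw≡Nρ : ∀ i → + y ℤ.* w i ≡ + N ℤ.* + ρ i
      yw≡Nρ i = ℤ→ℚ-injective (begin
        ℤ→ℚ (+ y ℤ.* (+ c ℤ.* ↥ f i))              ≡⟨ ℤ→ℚ-* (+ y) _ ⟩
        υ ℚ.* ℤ→ℚ (+ c ℤ.* ↥ f i)                      ≡⟨ cong (υ ℚ.*_) (ℤ→ℚ-* (+ c) (↥ f i)) ⟩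
        υ ℚ.* (ℤ→ℚ (+ c) ℚ.* ℤ→ℚ (↥ f i))              ≡⟨ cong (λ q → υ ℚ.* (ℤ→ℚ (+ c) ℚ.* q)) (/-*-denominator (↥ f i) (↧ₙ f i)) ⟨
        υ ℚ.* (ℤ→ℚ (+ c) ℚ.* ((↥ f i ℚ./ ↧ₙ f i) ℚ.* δ)) ≡⟨ cong (λ q → υ ℚ.* (ℤ→ℚ (+ c) ℚ.* (q ℚ.* δ))) (ℚₚ.↥p/↧p≡p (f i)) ⟩
        υ ℚ.* (ℤ→ℚ (+ c) ℚ.* (f i ℚ.* δ))              ≡⟨ regroup υ (ℤ→ℚ (+ c)) (f i) δ ⟩
        (ℤ→ℚ (+ c) ℚ.* δ) ℚ.* (f i ℚ.* υ)              ≡⟨ cong₂ ℚ._*_ cδ≡N (/-*-denominator (+ ρ i) y) ⟩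
        ℤ→ℚ (+ N) ℚ.* ℤ→ℚ (+ ρ i)                      ≡⟨ ℤ→ℚ-* (+ N) (+ ρ i) ⟨
        ℤ→ℚ (+ N ℤ.* + ρ i)                            ∎)
        where
        c = quotient (↧f∣N i)
        υ = ℤ→ℚ (+ y)
        δ = ℤ→ℚ (+ (↧ₙ f i))
        cδ≡N : ℤ→ℚ (+ c) ℚ.* δ ≡ ℤ→ℚ (+ N)
        cδ≡N = trans (sym (ℤ→ℚ-* (+ c) (+ (↧ₙ f i))))
          (cong ℤ→ℚ (trans (sym (ℤₚ.pos-* c (↧ₙ f i))) (cong +_ (sym (_∣_.equality (↧f∣N i))))))
        regroup : ∀ u c f e → u ℚ.* (c ℚ.* (f ℚ.* e)) ≡ (c ℚ.* e) ℚ.* (f ℚ.* u)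
        regroup = solve 4 (λ u c f e → u :* (c :* (f :* e)) := (c :* e) :* (f :* u)) refl
          where open +-*-Solver

      -- This is N x / y, as `w` is N times the fractional part of x / y.
      z : Vector ℤ (suc d)
      z i = w i ℤ.+ + N ℤ.* k i

      yAz : ∀ r → + y ℤ.* (A *ᵛ z) r ≡ + y ℤ.* (+ N ℤ.* Q r)
      yAz r = begin
        + y ℤ.* (A *ᵛ z) r
          ≡⟨ *ᵛ-* A (+ y) z r ⟨
        (A *ᵛ λ i → + y ℤ.* z i) r
          ≡⟨ *ᵛ-cong A (λ i → trans (ℤₚ.*-distribˡ-+ (+ y) (w i) (+ N ℤ.* k i))
               (trans (cong (ℤ._+ + y ℤ.* (+ N ℤ.* k i)) (yw≡Nρ i)) (factor (+ y) (+ N) (+ ρ i) (k i)))) r ⟩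
        (A *ᵛ λ i → + N ℤ.* (+ ρ i ℤ.+ k i ℤ.* + y)) r
          ≡⟨ *ᵛ-cong A (λ i → cong (+ N ℤ.*_) (ℤ-DivMod.a≡a%ℕn+[a/ℕn]*n (x i) y)) r ⟨
        (A *ᵛ λ i → + N ℤ.* x i) r
          ≡⟨ *ᵛ-* A (+ N) x r ⟩
        + N ℤ.* (A *ᵛ x) r
          ≡⟨ cong (+ N ℤ.*_) (Ax≡yQ r) ⟩
        + N ℤ.* (+ y ℤ.* Q r)
          ≡⟨ swap (+ N) (+ y) (Q r) ⟩
        + y ℤ.* (+ N ℤ.* Q r) ∎
        where
        factor : ∀ y n a k → n ℤ.* a ℤ.+ y ℤ.* (n ℤ.* k) ≡ n ℤ.* (a ℤ.+ k ℤ.* y)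
        factor = solve-∀
        swap : ∀ a b c → a ℤ.* (b ℤ.* c) ≡ b ℤ.* (a ℤ.* c)
        swap = solve-∀

    abstract
      scaledPreimage : ∀ Q → ∃[ z ] Scaled N z Q
      scaledPreimage Q =
        let y , y≢0 , x , Ax≡yQ = rationalSolution A A-injective₀ Q
        in clearDenominator y {{y≢0}} x Q Ax≡yQ

    -- The barycentric coordinates t are only real, so the integers come from the preimage z
    -- instead; N t tends to z, which carries nonnegativity from t to z.
    latticePoint⇒scaled : ∀ {p h} → IsLatticePointOfΔ×1 Δ (p , h) →
      ∃[ n ] Scaled N (λ i → + n i) (h ∷ p)
    latticePoint⇒scaled {p} {h} ((t , 0≤t , ∑t≃1 , p≃comb) , h≡1) =
      let z , Az≡NQ = scaledPreimage (h ∷ p)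
          Nt≃z = solves⇒scaled N t z (h ∷ p) At≃Q Az≡NQ
          natural = λ i → ℤ→ℚ-nonNeg⇒natural (z i) (limit-nonNeg {ℤ→ℚ (+ N) · t i} {ℤ→ℚ (z i)} (·-nonNeg (ℤ→ℚ (+ N)) {{ℤ→ℚ-pos N}} {t i} (0≤t i)) (Nt≃z i))
      in (proj₁ ∘ natural) , λ r →
         trans (*ᵛ-cong A (λ i → sym (proj₂ (natural i))) r) (Az≡NQ r)
      where
      At≃Q : Solves t (h ∷ p)
      At≃Q = solves t (h ∷ p) (subst (λ h → ∑ᴿ t ≃ fromℤ h) (sym h≡1) ∑t≃1)
                    (λ j → Null-swap {λ _ → ℤ→ℚ (p j)} {seq (comb t (vertex Δ) j)} (p≃comb j))

    scaled⇒latticePoint : ∀ (n : Vector ℕ (suc d)) Q → Scaled N (+_ ∘ n) Q → Q zero ≡ 1ℤ →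
                          IsLatticePointOfΔ×1 Δ (Q ∘ suc , Q zero)
    scaled⇒latticePoint n Q An≡NQ Q₀≡1 =
      ( t
      , (λ i → fromℚ-nonNeg (/-nonNeg (n i) N))
      , subst (λ h → ∑ᴿ t ≃ fromℤ h) Q₀≡1 (solves⇒level t Q At≃Q)
      , λ j → Null-swap {seq (comb t (vertex Δ) j)} {λ _ → ℤ→ℚ (Q (suc j))} (solves⇒point t Q At≃Q j) ) , Q₀≡1
      where
      t : Vector ℝ (suc d)
      t i = fromℚ (+ n i ℚ./ N)
      At≃Q : Solves t Q
      At≃Q = scaled⇒solves N (+_ ∘ n) Q An≡NQ

    -- The word c and the integer preimage z are both limits of N times the real fractional parts,
    -- and constants with the same limit are equal.
    inCode⇒scaled : ∀ c → InCode Δ N c → ∃[ Q ] Scaled N (λ i → + toℕ (c i)) Q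
    inCode⇒scaled c (x , x∈Λ , c≃Nf) = Q , λ r → trans (*ᵛ-cong A c≡z r) (Az≡NQ r)
      where
      f : Vector ℝ (suc d)
      f = frac x∈Λ

      Q z : Vector ℤ (suc d)
      Q = level x∈Λ ∷ point x∈Λ
      z = proj₁ (scaledPreimage Q)

      Az≡NQ : Scaled N z Q
      Az≡NQ = proj₂ (scaledPreimage Q)

      c≡z : ∀ i → + toℕ (c i) ≡ z i
      c≡z i = ℤ→ℚ-injective (p-q≡0⇒p≡q (ℤ→ℚ (+ toℕ (c i))) (ℤ→ℚ (z i)) (Null-const
        (Null-trans {λ _ → ℤ→ℚ (+ toℕ (c i))} {λ n → ℤ→ℚ (+ N) ℚ.* seq (f i) n} {λ _ → ℤ→ℚ (z i)} (c≃Nf i)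
          (solves⇒scaled N f z Q (solves f Q (level-eq x∈Λ) (point-eq x∈Λ)) Az≡NQ i))))

    scaled⇒inCode : ∀ c Q → Scaled N (λ i → + toℕ (c i)) Q → InCode Δ N c
    scaled⇒inCode c Q Ac≡NQ =
      (λ i → fromℚ (+ toℕ (c i) ℚ./ N)) , scaled⇒∈Λ N (toℕ ∘ c) Q (λ i → toℕ<n (c i)) Ac≡NQ ,
      λ i → Null-0 λ _ → trans (cong (λ q → ℤ→ℚ (+ toℕ (c i)) ℚ.- q)
        (trans (ℚₚ.*-comm (ℤ→ℚ (+ N)) (+ toℕ (c i) ℚ./ N)) (/-*-denominator (+ toℕ (c i)) N)))
        (ℚₚ.+-inverseʳ (ℤ→ℚ (+ toℕ (c i))))

-- Spans modulo N

lin : ∀ {k n} → Vector ℤ k → (Fin k → Vector ℤ n) → Vector ℤ n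
lin a z i = ∑ᶻ λ l → a l ℤ.* z l i

lin-assoc : ∀ {k r n} (a : Vector ℤ k) (c : Fin k → Vector ℤ r) (w : Fin r → Vector ℤ n) i →
            lin a (λ l → lin (c l) w) i ≡ lin (lin a c) w i
lin-assoc a c w i = begin
  lin a (λ l → lin (c l) w) i
    ≡⟨ sum-cong-≗ (λ l → cong (a l ℤ.*_) (sum-cong-≗ λ j → ℤₚ.*-comm (c l j) (w j i))) ⟩
  (∑ᶻ λ l → a l ℤ.* (wᵀ *ᵛ c l) i)
    ≡⟨ *ᵛ-∑ wᵀ a c i ⟨
  (wᵀ *ᵛ lin a c) i
    ≡⟨ sum-cong-≗ (λ j → ℤₚ.*-comm (w j i) (lin a c j)) ⟩
  lin (lin a c) w i ∎
  where
  open ≡-Reasoning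
  wᵀ = λ i j → w j i

-- Natural-valued, so that N times it can serve as the numerators of the barycentric coordinates of
-- a vertex.
unit : ∀ {n} → Fin n → Vector ℕ n
unit zero    = 1 ∷ λ _ → 0
unit (suc j) = 0 ∷ unit j

∑-unit : ∀ {n} (x : Vector ℤ n) j → (∑ᶻ λ i → x i ℤ.* + unit j i) ≡ x j
∑-unit x zero    = trans (cong₂ ℤ._+_ (ℤₚ.*-identityʳ (x zero)) (∑ᶻ-zero λ i → ℤₚ.*-zeroʳ (x (suc i))))
                         (ℤₚ.+-identityʳ (x zero))
∑-unit x (suc j) = trans (cong₂ ℤ._+_ (ℤₚ.*-zeroʳ (x zero)) (∑-unit (x ∘ suc) j)) (ℤₚ.+-identityˡ (x (suc j)))

pos-∑ : ∀ {n} (x : Vector ℕ n) → + ∑ᴺ x ≡ ∑ᶻ (+_ ∘ x)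
pos-∑ {zero}  x = refl
pos-∑ {suc n} x = cong (λ s → + x zero ℤ.+ s) (pos-∑ (x ∘ suc))

∑-split : ∀ m {n} (f : Vector ℤ (m ℕ.+ n)) → ∑ᶻ f ≡ ∑ᶻ (λ i → f (i ↑ˡ n)) ℤ.+ ∑ᶻ (λ i → f (m ↑ʳ i))
∑-split zero    f = sym (ℤₚ.+-identityˡ (∑ᶻ f))
∑-split (suc m) f = trans (cong (λ s → f zero ℤ.+ s) (∑-split m (f ∘ suc))) (sym (ℤₚ.+-assoc (f zero) _ _))

∑ᴺ≡0 : ∀ {n} (x : Vector ℕ n) → ∑ᴺ x ≡ 0 → ∀ i → x i ≡ 0
∑ᴺ≡0 x ∑≡0 zero    = ℕₚ.m+n≡0⇒m≡0 (x zero) ∑≡0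
∑ᴺ≡0 x ∑≡0 (suc i) = ∑ᴺ≡0 (x ∘ suc) (ℕₚ.m+n≡0⇒n≡0 (x zero) ∑≡0) i

-- An entry that exhausts the total leaves zero for all others. Both values, N and 0, are recorded
-- as multiples of N because that is how a vertex vanishes modulo N.
concentrated : ∀ {n N} (x : Vector ℕ n) → ∑ᴺ x ≡ N → ∀ i → N ℕ.≤ x i → ∀ j → ∃[ k ] x j ≡ N ℕ.* k
concentrated {suc n} {N} x ∑x≡N i N≤xᵢ j with i Finₚ.≟ j
... | yes refl = 1 , trans (ℕₚ.≤-antisym xᵢ≤N N≤xᵢ) (sym (ℕₚ.*-identityʳ N))
  where
  xᵢ≤N : x i ℕ.≤ N
  xᵢ≤N = subst (x i ℕ.≤_) (trans (sym (ℕ-Sum.sum-remove {i = i} x)) ∑x≡N) (ℕₚ.m≤m+n (x i) _)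
... | no i≢j = 0 , (begin
  x j                          ≡⟨ cong x (punchIn-punchOut i≢j) ⟨
  x (punchIn i (punchOut i≢j)) ≡⟨ ∑ᴺ≡0 (x ∘ punchIn i) rest≡0 (punchOut i≢j) ⟩
  0                            ≡⟨ ℕₚ.*-zeroʳ N ⟨
  N ℕ.* 0                      ∎)
  where
  open ≡-Reasoning
  rest = ∑ᴺ (x ∘ punchIn i)
  x+rest≡N : x i ℕ.+ rest ≡ N
  x+rest≡N = trans (sym (ℕ-Sum.sum-remove {i = i} x)) ∑x≡N
  rest≡0 : rest ≡ 0
  rest≡0 = ℕₚ.n≤0⇒n≡0 (ℕₚ.+-cancelˡ-≤ (x i) rest 0
    (ℕₚ.≤-trans (ℕₚ.≤-reflexive x+rest≡N) (ℕₚ.≤-trans N≤xᵢ (ℕₚ.≤-reflexive (sym (ℕₚ.+-identityʳ (x i)))))))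

module _ {N : ℕ} .{{_ : NonZero N}} where

  toℕ-mod : ∀ x → toℕ (x mod N) ≡ x % N
  toℕ-mod x = toℕ-fromℕ< (m%n<n x N)

  -- Removing a multiple of N from a remainder is an operation on naturals, so a negative k is moved
  -- to the other side.
  residue-unique : ∀ {m x} k → m ℕ.< N → + m ≡ + x ℤ.+ + N ℤ.* k → m ≡ x % N
  residue-unique {m} {x} (+ k) m<N eq = begin
    m                    ≡⟨ m<n⇒m%n≡m m<N ⟨
    m % N                ≡⟨ cong (_% N) (ℤₚ.+-injective (trans eq (trans (cong (λ y → + x ℤ.+ y) (trans (ℤₚ.*-comm (+ N) (+ k)) (sym (ℤₚ.pos-* k N)))) (sym (ℤₚ.pos-+ x (k ℕ.* N)))))) ⟩
    (x ℕ.+ k ℕ.* N) % N  ≡⟨ [m+kn]%n≡m%n x k N ⟩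
    x % N                ∎
    where open ≡-Reasoning
  residue-unique {m} {x} -[1+ k ] m<N eq = sym $ begin
    x % N                    ≡⟨ cong (_% N) (ℤₚ.+-injective x≡) ⟩
    (m ℕ.+ suc k ℕ.* N) % N  ≡⟨ [m+kn]%n≡m%n m (suc k) N ⟩
    m % N                    ≡⟨ m<n⇒m%n≡m m<N ⟩
    m                        ∎
    where
    open ≡-Reasoning
    move : ∀ x n k → x ≡ (x ℤ.+ n ℤ.* ℤ.- k) ℤ.+ k ℤ.* n
    move = solve-∀
    x≡ : + x ≡ + (m ℕ.+ suc k ℕ.* N)
    x≡ = begin
      + x                                                  ≡⟨ move (+ x) (+ N) (+ suc k) ⟩
      (+ x ℤ.+ + N ℤ.* -[1+ k ]) ℤ.+ + suc k ℤ.* + N       ≡⟨ cong (ℤ._+ + suc k ℤ.* + N) eq ⟨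
      + m ℤ.+ + suc k ℤ.* + N                              ≡⟨ cong (λ y → + m ℤ.+ y) (ℤₚ.pos-* (suc k) N) ⟨
      + m ℤ.+ + (suc k ℕ.* N)                              ≡⟨ ℤₚ.pos-+ m (suc k ℕ.* N) ⟨
      + (m ℕ.+ suc k ℕ.* N)                                ∎

  reduce : ℤ → Fin N
  reduce x = fromℕ< (ℤ-DivMod.n%ℕd<d x N)

  reduce-eq : ∀ x → + toℕ (reduce x) ≡ x ℤ.+ + N ℤ.* ℤ.- (x ℤ-DivMod./ℕ N)
  reduce-eq x = begin
    + toℕ (reduce x)     ≡⟨ cong +_ (toℕ-fromℕ< (ℤ-DivMod.n%ℕd<d x N)) ⟩
    + (x ℤ-DivMod.%ℕ N)  ≡⟨ isolate (+ (x ℤ-DivMod.%ℕ N)) (x ℤ-DivMod./ℕ N) (+ N) ⟩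
    (+ (x ℤ-DivMod.%ℕ N) ℤ.+ (x ℤ-DivMod./ℕ N) ℤ.* + N) ℤ.+ + N ℤ.* ℤ.- (x ℤ-DivMod./ℕ N)
                         ≡⟨ cong (ℤ._+ + N ℤ.* ℤ.- (x ℤ-DivMod./ℕ N)) (ℤ-DivMod.a≡a%ℕn+[a/ℕn]*n x N) ⟨
    x ℤ.+ + N ℤ.* ℤ.- (x ℤ-DivMod./ℕ N) ∎
    where
    open ≡-Reasoning
    isolate : ∀ a b n → a ≡ (a ℤ.+ b ℤ.* n) ℤ.+ n ℤ.* ℤ.- b
    isolate = solve-∀

  module _ {n r} (g : Vector (Word N n) r) where

    rows : Fin r → Vector ℤ n
    rows j i = + toℕ (g j i)

    -- The row span lifted to ℤ. With integer coefficients and an explicit multiple of N it is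
    -- closed under integer combinations and free of `mod`, and k remains available for recovering
    -- vertices.
    ModularSpan : Vector ℤ n → Set
    ModularSpan z = Σ[ a ∈ Vector ℤ r ] Σ[ k ∈ Vector ℤ n ] (∀ i → z i ≡ lin a rows i ℤ.+ + N ℤ.* k i)

    lift-combination : ∀ (a : Vector (Fin N) r) i →
      + (∑ᴺ λ j → toℕ (a j) ℕ.* toℕ (g j i)) ≡ lin (λ j → + toℕ (a j)) rows i
    lift-combination a i = trans (pos-∑ λ j → toℕ (a j) ℕ.* toℕ (g j i))
      (sum-cong-≗ λ j → ℤₚ.pos-* (toℕ (a j)) (toℕ (g j i)))

    rowSpan⇒modular : ∀ c → c ∈RowSpan g → ModularSpan (λ i → + toℕ (c i))
    rowSpan⇒modular c (a , c≡) = (λ j → + toℕ (a j)) , (λ i → ℤ.- + (X i / N)) , λ i → begin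
      + toℕ (c i)                                             ≡⟨ cong (λ b → + toℕ b) (c≡ i) ⟩
      + toℕ (X i mod N)                                       ≡⟨ cong +_ (toℕ-mod (X i)) ⟩
      + (X i % N)                                             ≡⟨ isolate (+ (X i % N)) (+ (X i / N)) (+ N) ⟩
      (+ (X i % N) ℤ.+ + (X i / N) ℤ.* + N) ℤ.+ + N ℤ.* ℤ.- + (X i / N)
                                                              ≡⟨ cong (ℤ._+ + N ℤ.* ℤ.- + (X i / N)) (divide i) ⟨
      + X i ℤ.+ + N ℤ.* ℤ.- + (X i / N)                       ≡⟨ cong (ℤ._+ + N ℤ.* ℤ.- + (X i / N)) (lift-combination a i) ⟩
      lin (λ j → + toℕ (a j)) rows i ℤ.+ + N ℤ.* ℤ.- + (X i / N) ∎
      where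
      open ≡-Reasoning
      X : Vector ℕ n
      X i = ∑ᴺ λ j → toℕ (a j) ℕ.* toℕ (g j i)
      isolate : ∀ a b n → a ≡ (a ℤ.+ b ℤ.* n) ℤ.+ n ℤ.* ℤ.- b
      isolate = solve-∀
      divide : ∀ i → + X i ≡ + (X i % N) ℤ.+ + (X i / N) ℤ.* + N
      divide i = trans (cong +_ (m≡m%n+[m/n]*n (X i) N))
        (trans (ℤₚ.pos-+ (X i % N) (X i / N ℕ.* N)) (cong (λ y → + (X i % N) ℤ.+ y) (ℤₚ.pos-* (X i / N) N)))

    -- Replacing each coefficient by its residue changes the combination by N times a combination of
    -- rows, which the multiple of N absorbs.
    modular⇒rowSpan : ∀ c → ModularSpan (λ i → + toℕ (c i)) → c ∈RowSpan g
    modular⇒rowSpan c (a , k , c≡) = a′ , λ i →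
      toℕ-injective (trans (residue-unique {x = X i} (k i ℤ.+ lin q rows i) (toℕ<n (c i)) (begin
        + toℕ (c i)                                                     ≡⟨ c≡ i ⟩
        lin a rows i ℤ.+ + N ℤ.* k i                                    ≡⟨ regroup (lin a rows i) (+ N) (k i) (lin q rows i) ⟩
        (lin a rows i ℤ.+ ℤ.- + N ℤ.* lin q rows i) ℤ.+ + N ℤ.* (k i ℤ.+ lin q rows i)
                                                                        ≡⟨ cong (ℤ._+ + N ℤ.* (k i ℤ.+ lin q rows i)) (X≡ i) ⟨
        + X i ℤ.+ + N ℤ.* (k i ℤ.+ lin q rows i)                        ∎))
        (sym (toℕ-mod (X i))))
      where
      open ≡-Reasoning
      a′ : Vector (Fin N) r
      a′ j = reduce (a j)
      q : Vector ℤ r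
      q j = a j ℤ-DivMod./ℕ N
      X : Vector ℕ n
      X i = ∑ᴺ λ j → toℕ (a′ j) ℕ.* toℕ (g j i)
      regroup : ∀ a n k q → a ℤ.+ n ℤ.* k ≡ (a ℤ.+ ℤ.- n ℤ.* q) ℤ.+ n ℤ.* (k ℤ.+ q)
      regroup = solve-∀
      expand : ∀ a n q g → (a ℤ.+ n ℤ.* ℤ.- q) ℤ.* g ≡ a ℤ.* g ℤ.+ ℤ.- n ℤ.* (q ℤ.* g)
      expand = solve-∀
      X≡ : ∀ i → + X i ≡ lin a rows i ℤ.+ ℤ.- + N ℤ.* lin q rows i
      X≡ i = begin
        + X i
          ≡⟨ lift-combination a′ i ⟩
        lin (λ j → + toℕ (a′ j)) rows i
          ≡⟨ sum-cong-≗ (λ j → trans (cong (ℤ._* rows j i) (reduce-eq (a j))) (expand (a j) (+ N) (q j) (rows j i))) ⟩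
        (∑ᶻ λ j → a j ℤ.* rows j i ℤ.+ ℤ.- + N ℤ.* (q j ℤ.* rows j i))
          ≡⟨ ∑-distrib-+ (λ j → a j ℤ.* rows j i) (λ j → ℤ.- + N ℤ.* (q j ℤ.* rows j i)) ⟩
        lin a rows i ℤ.+ (∑ᶻ λ j → ℤ.- + N ℤ.* (q j ℤ.* rows j i))
          ≡⟨ cong (λ y → lin a rows i ℤ.+ y) (*-distribˡ-sum (ℤ.- + N) λ j → q j ℤ.* rows j i) ⟨
        lin a rows i ℤ.+ ℤ.- + N ℤ.* lin q rows i ∎

    modular-row : ∀ j → ModularSpan (rows j)
    modular-row j = (λ l → + unit j l) , (λ _ → 0ℤ) , λ i → sym $ begin
      lin (λ l → + unit j l) rows i ℤ.+ + N ℤ.* 0ℤ  ≡⟨ cong₂ ℤ._+_ (trans (sum-cong-≗ λ l → ℤₚ.*-comm (+ unit j l) (rows l i))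
                                                                    (∑-unit (λ l → rows l i) j)) (ℤₚ.*-zeroʳ (+ N)) ⟩
      rows j i ℤ.+ 0ℤ                               ≡⟨ ℤₚ.+-identityʳ (rows j i) ⟩
      rows j i                                      ∎
      where open ≡-Reasoning

    modular-multiple : ∀ k → ModularSpan (λ i → + N ℤ.* k i)
    modular-multiple k = (λ _ → 0ℤ) , k , λ i → sym $
      trans (cong (ℤ._+ + N ℤ.* k i) (∑ᶻ-zero λ j → ℤₚ.*-zeroˡ (rows j i))) (ℤₚ.+-identityˡ (+ N ℤ.* k i))

    modular-resp : ∀ {y z} → (∀ i → y i ≡ z i) → ModularSpan y → ModularSpan z
    modular-resp y≗z (a , k , y≡) = a , k , λ i → trans (sym (y≗z i)) (y≡ i)

    modular-lin : ∀ {m} (a : Vector ℤ m) z → (∀ l → ModularSpan (z l)) → ModularSpan (lin a z)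
    modular-lin a z z∈ = lin a c , lin a k , λ i → begin
      lin a z i
        ≡⟨ sum-cong-≗ (λ l → trans (cong (a l ℤ.*_) (proj₂ (proj₂ (z∈ l)) i))
             (expand (a l) (lin (c l) rows i) (+ N) (k l i))) ⟩
      (∑ᶻ λ l → a l ℤ.* lin (c l) rows i ℤ.+ + N ℤ.* (a l ℤ.* k l i))
        ≡⟨ ∑-distrib-+ (λ l → a l ℤ.* lin (c l) rows i) (λ l → + N ℤ.* (a l ℤ.* k l i)) ⟩
      lin a (λ l → lin (c l) rows) i ℤ.+ (∑ᶻ λ l → + N ℤ.* (a l ℤ.* k l i))
        ≡⟨ cong₂ ℤ._+_ (lin-assoc a c rows i) (sym (*-distribˡ-sum (+ N) λ l → a l ℤ.* k l i)) ⟩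
      lin (lin a c) rows i ℤ.+ + N ℤ.* lin a k i ∎
      where
      open ≡-Reasoning
      c = λ l → proj₁ (z∈ l)
      k = λ l → proj₁ (proj₂ (z∈ l))
      expand : ∀ a c n k → a ℤ.* (c ℤ.+ n ℤ.* k) ≡ a ℤ.* c ℤ.+ n ℤ.* (a ℤ.* k)
      expand = solve-∀

-- Codewords of height one

module _ {d} (Δ : LatticeSimplex d) {N : ℕ} .{{_ : NonZero N}} (isN : IsN Δ N) where

  open Homogenised Δ

  scaled-lin : ∀ {k} (a : Vector ℤ k) z Q → (∀ l → Scaled N (z l) (Q l)) → Scaled N (lin a z) (lin a Q)
  scaled-lin a z Q Az≡NQ s = begin
    (A *ᵛ lin a z) s                    ≡⟨ *ᵛ-∑ A a z s ⟩
    (∑ᶻ λ l → a l ℤ.* (A *ᵛ z l) s)     ≡⟨ sum-cong-≗ (λ l → trans (cong (a l ℤ.*_) (Az≡NQ l s)) (swap (a l) (+ N) (Q l s))) ⟩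
    (∑ᶻ λ l → + N ℤ.* (a l ℤ.* Q l s))  ≡⟨ *-distribˡ-sum (+ N) (λ l → a l ℤ.* Q l s) ⟨
    + N ℤ.* lin a Q s                   ∎
    where
    open ≡-Reasoning
    swap : ∀ a b c → a ℤ.* (b ℤ.* c) ≡ b ℤ.* (a ℤ.* c)
    swap = solve-∀

  -- A sends N k to N (A k), so the discrepancy modulo N turns into the integral combination A k of
  -- homogenised vertices.
  scaled-modular : ∀ {r} (g : Vector (Word N (suc d)) r) (Q : Fin r → Vector ℤ (suc d)) →
    (∀ j → Scaled N (rows g j) (Q j)) → ∀ {z} ((a , k , _) : ModularSpan g z) →
    Scaled N z (λ s → lin a Q s ℤ.+ (A *ᵛ k) s)
  scaled-modular g Q Ag≡NQ {z} (a , k , z≡) s = begin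
    (A *ᵛ z) s                                            ≡⟨ *ᵛ-cong A z≡ s ⟩
    (A *ᵛ λ i → lin a (rows g) i ℤ.+ + N ℤ.* k i) s       ≡⟨ *ᵛ-+ A (lin a (rows g)) (λ i → + N ℤ.* k i) s ⟩
    (A *ᵛ lin a (rows g)) s ℤ.+ (A *ᵛ λ i → + N ℤ.* k i) s ≡⟨ cong₂ ℤ._+_ (scaled-lin a (rows g) Q Ag≡NQ s) (*ᵛ-* A (+ N) k s) ⟩
    + N ℤ.* lin a Q s ℤ.+ + N ℤ.* (A *ᵛ k) s              ≡⟨ ℤₚ.*-distribˡ-+ (+ N) (lin a Q s) ((A *ᵛ k) s) ⟨
    + N ℤ.* (lin a Q s ℤ.+ (A *ᵛ k) s)                    ∎
    where open ≡-Reasoning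

  -- The top row of A consists of ones, so for a codeword the level of its lattice point is its
  -- height.
  scaled-level : ∀ (n : Vector ℕ (suc d)) Q → Scaled N (+_ ∘ n) Q → + ∑ᴺ n ≡ + N ℤ.* Q zero
  scaled-level n Q An≡NQ = trans (pos-∑ n)
    (trans (sum-cong-≗ λ i → sym (ℤₚ.*-identityˡ (+ n i))) (An≡NQ zero))

  height-one : ∀ (c : Word N (suc d)) → height c ≡ 1ℚ ⇔ ∑ᴺ (toℕ ∘ c) ≡ N
  height-one c = mk⇔
    (λ h≡1 → ℤₚ.+-injective (ℤ→ℚ-injective (begin
      ℤ→ℚ (+ ∑ᴺ (toℕ ∘ c))      ≡⟨ /-*-denominator (+ ∑ᴺ (toℕ ∘ c)) N ⟨
      height c ℚ.* ℤ→ℚ (+ N)    ≡⟨ cong (ℚ._* ℤ→ℚ (+ N)) h≡1 ⟩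
      1ℚ ℚ.* ℤ→ℚ (+ N)          ≡⟨ ℚₚ.*-identityˡ (ℤ→ℚ (+ N)) ⟩
      ℤ→ℚ (+ N)                 ∎)))
    (λ ∑≡N → *-ℤ→ℚ-cancelʳ N {height c} {1ℚ} (begin
      height c ℚ.* ℤ→ℚ (+ N)    ≡⟨ /-*-denominator (+ ∑ᴺ (toℕ ∘ c)) N ⟩
      ℤ→ℚ (+ ∑ᴺ (toℕ ∘ c))      ≡⟨ cong (λ s → ℤ→ℚ (+ s)) ∑≡N ⟩
      ℤ→ℚ (+ N)                 ≡⟨ ℚₚ.*-identityˡ (ℤ→ℚ (+ N)) ⟨
      1ℚ ℚ.* ℤ→ℚ (+ N)          ∎))
    where open ≡-Reasoning

  -- Code membership as an integer condition: `InCode` quantifies over real tuples, whereas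
  -- divisibility of A c by N can be tested word by word.
  HeightOneCodeword : Word N (suc d) → Set
  HeightOneCodeword c = ∑ᴺ (toℕ ∘ c) ≡ N × (∀ s → + N ℤ-Div.∣ (A *ᵛ λ i → + toℕ (c i)) s)

  heightOneCodeword? : ∀ c → Dec (HeightOneCodeword c)
  heightOneCodeword? c = (∑ᴺ (toℕ ∘ c) ℕₚ.≟ N) ×-dec all? (λ s → + N ℤ-Div.∣? (A *ᵛ λ i → + toℕ (c i)) s)

  -- Words are functions, and decoding the index of a word returns it only up to pointwise equality.
  heightOneCodeword-resp : ∀ {b c} → (∀ i → b i ≡ c i) → HeightOneCodeword b → HeightOneCodeword c
  heightOneCodeword-resp b≗c (∑b≡N , N∣Ab) =
    trans (ℕ-Sum.sum-cong-≗ λ i → cong toℕ (sym (b≗c i))) ∑b≡N ,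
    λ s → subst (+ N ℤ-Div.∣_) (*ᵛ-cong A (λ i → cong (λ x → + toℕ x) (b≗c i)) s) (N∣Ab s)

  heightOneIndices : List (Fin (N ℕ.^ suc d))
  heightOneIndices = filter (heightOneCodeword? ∘ finToFun) (allFin (N ℕ.^ suc d))

  heightOneWords : Vector (Word N (suc d)) (length heightOneIndices)
  heightOneWords j = finToFun (lookup heightOneIndices j)

  heightOneWords-sound : ∀ j → HeightOneCodeword (heightOneWords j)
  heightOneWords-sound j = proj₂ (∈-filter⁻ (heightOneCodeword? ∘ finToFun) {xs = allFin (N ℕ.^ suc d)} (∈-lookup {xs = heightOneIndices} j))

  heightOneWords-complete : ∀ c → HeightOneCodeword c → ∃[ j ] (∀ i → heightOneWords j i ≡ c i)
  heightOneWords-complete c c∈ = index e∈heightOneIndices , λ i →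
    trans (cong (λ e → finToFun e i) (sym (lookup-index e∈heightOneIndices))) (finToFun-funToFin c i)
    where
    e∈heightOneIndices = ∈-filter⁺ (heightOneCodeword? ∘ finToFun) (∈-allFin (funToFin c))
      (heightOneCodeword-resp (sym ∘ finToFun-funToFin c) c∈)

  -- A lattice point of Δ other than a vertex has all barycentric coordinates
  -- below 1 and gives a word of height one; a vertex gives the zero word.
  latticePoint∈span : ∀ (n : Vector ℕ (suc d)) Q → Scaled N (+_ ∘ n) Q → Q zero ≡ 1ℤ →
                      ModularSpan heightOneWords (+_ ∘ n)
  latticePoint∈span n Q An≡NQ Q₀≡1 with all? (λ i → n i ℕₚ.<? N)
  ... | yes n<N =
    let j , gⱼ≡c = heightOneWords-complete c (heightOne , divisible)
    in modular-resp heightOneWords (λ i → trans (cong (λ x → + toℕ x) (gⱼ≡c i)) (c≡n i)) (modular-row heightOneWords j)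
    where
    c : Word N (suc d)
    c i = fromℕ< (n<N i)
    c≡n : ∀ i → + toℕ (c i) ≡ + n i
    c≡n i = cong +_ (toℕ-fromℕ< (n<N i))
    heightOne : ∑ᴺ (toℕ ∘ c) ≡ N
    heightOne = trans (ℕ-Sum.sum-cong-≗ λ i → toℕ-fromℕ< (n<N i)) (ℤₚ.+-injective
      (trans (scaled-level n Q An≡NQ) (trans (cong (+ N ℤ.*_) Q₀≡1) (ℤₚ.*-identityʳ (+ N)))))
    divisible : ∀ s → + N ℤ-Div.∣ (A *ᵛ λ i → + toℕ (c i)) s
    divisible s = ℤ-Div.divides (Q s) (trans (*ᵛ-cong A c≡n s) (trans (An≡NQ s) (ℤₚ.*-comm (+ N) (Q s))))
  ... | no n≮N =
    let i , nᵢ≮N = ¬∀⟶∃¬ _ _ (λ i → n i ℕₚ.<? N) n≮N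
        multiple = concentrated n ∑n≡N i (ℕₚ.≮⇒≥ nᵢ≮N)
    in modular-resp heightOneWords
         (λ j → trans (sym (ℤₚ.pos-* N (proj₁ (multiple j)))) (cong +_ (sym (proj₂ (multiple j)))))
         (modular-multiple heightOneWords λ j → + proj₁ (multiple j))
    where
    ∑n≡N : ∑ᴺ n ≡ N
    ∑n≡N = ℤₚ.+-injective
      (trans (scaled-level n Q An≡NQ) (trans (cong (+ N ℤ.*_) Q₀≡1) (ℤₚ.*-identityʳ (+ N))))

  spanning⇒generates : Spanning Δ → Generates Δ N heightOneWords
  spanning⇒generates spanning c = mk⇔ sound complete
    where
    g = heightOneWords

    Qᵍ : Fin (length heightOneIndices) → Vector ℤ (suc d)
    Qᵍ j s = ℤ-Div._∣_.quotient (proj₂ (heightOneWords-sound j) s)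

    Ag : ∀ j → Scaled N (rows g j) (Qᵍ j)
    Ag j s = trans (ℤ-Div._∣_.equality (proj₂ (heightOneWords-sound j) s)) (ℤₚ.*-comm (Qᵍ j s) (+ N))

    sound : c ∈RowSpan g → InCode Δ N c
    sound c∈span =
      let c∈@(a , k , _) = rowSpan⇒modular g c c∈span
      in scaled⇒inCode isN c (λ s → lin a Qᵍ s ℤ.+ (A *ᵛ k) s) (scaled-modular g Qᵍ Ag c∈)

    complete : InCode Δ N c → c ∈RowSpan g
    complete c∈code =
      let Q , Ac≡NQ = inCode⇒scaled isN c c∈code
          k , p , lattice , a , point , level = spanning (Q ∘ suc , Q zero)
          P = λ l → proj₂ (p l) ∷ proj₁ (p l)
          n = λ l → proj₁ (latticePoint⇒scaled isN (lattice l))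
          An≡NP = λ l → proj₂ (latticePoint⇒scaled isN (lattice l))
          Q≡ : ∀ s → Q s ≡ lin a P s
          Q≡ = λ where
            zero    → level
            (suc j) → point j
          -- Both vectors have image N Q under A, so they agree over ℤ and not merely modulo N.
          c≡ = A-injective (lin a (λ l i → + n l i)) (λ i → + toℕ (c i)) λ s →
                 trans (scaled-lin a (λ l i → + n l i) P An≡NP s)
                   (trans (cong (+ N ℤ.*_) (sym (Q≡ s))) (sym (Ac≡NQ s)))
      in modular⇒rowSpan g c (modular-resp g c≡ (modular-lin g a (λ l i → + n l i)
           λ l → latticePoint∈span (n l) (P l) (An≡NP l) (proj₂ (lattice l))))

  -- From generating rows of height one to lattice points spanning the lattice

  vertex-scaled : ∀ j → Scaled N (λ i → + (N ℕ.* unit j i)) (λ s → A s j)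
  vertex-scaled j s = trans (*ᵛ-cong A (λ i → ℤₚ.pos-* N (unit j i)) s)
    (trans (*ᵛ-* A (+ N) (λ i → + unit j i) s) (cong (+ N ℤ.*_) (∑-unit (A s) j)))

  module _ {r} (g : Vector (Word N (suc d)) r) (generates : Generates Δ N g)
           (heights : ∀ j → height (g j) ≡ 1ℚ) where

    -- Each row lies in its own row span, so `generates` makes it a codeword.
    rowPoint : ∀ j → ∃[ Q ] Scaled N (rows g j) Q
    rowPoint j = inCode⇒scaled isN (g j)
      (Equivalence.to (generates (g j)) (modular⇒rowSpan g (g j) (modular-row g j)))

    -- Here the height hypothesis enters: it puts the lattice point of each row at level one.
    rowPoint-level : ∀ j → proj₁ (rowPoint j) zero ≡ 1ℤ
    rowPoint-level j = sym (ℤₚ.*-cancelˡ-≡ (+ N) 1ℤ (Q zero) {{ℤ.≢-nonZero (ℕ.≢-nonZero⁻¹ N ∘ ℤₚ.+-injective)}} (begin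
      + N ℤ.* 1ℤ             ≡⟨ ℤₚ.*-identityʳ (+ N) ⟩
      + N                    ≡⟨ cong +_ (Equivalence.to (height-one (g j)) (heights j)) ⟨
      + ∑ᴺ (toℕ ∘ g j)       ≡⟨ scaled-level (toℕ ∘ g j) Q (proj₂ (rowPoint j)) ⟩
      + N ℤ.* Q zero         ∎))
      where
      open ≡-Reasoning
      Q = proj₁ (rowPoint j)

    fromHomogeneous : Vector ℤ (suc d) → M⊕ℤ d
    fromHomogeneous Q = Q ∘ suc , Q zero

    generators : Vector (M⊕ℤ d) (r ℕ.+ suc d)
    generators = (λ j → fromHomogeneous (proj₁ (rowPoint j))) ++ (λ i → fromHomogeneous λ s → A s i)

    generators-lattice : ∀ l → IsLatticePointOfΔ×1 Δ (generators l)
    generators-lattice = ++⁺ (IsLatticePointOfΔ×1 Δ)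
      (λ j → scaled⇒latticePoint isN (toℕ ∘ g j) (proj₁ (rowPoint j)) (proj₂ (rowPoint j)) (rowPoint-level j))
      (λ i → scaled⇒latticePoint isN (λ k → N ℕ.* unit i k) (λ s → A s i) (vertex-scaled i) refl)

    -- Reducing N A⁻¹ Q modulo N gives a codeword, hence a combination of rows
    -- of g; the multiples of N discarded are accounted for by the vertices.
    decompose : ∀ Q → Σ[ a ∈ Vector ℤ r ] Σ[ k ∈ Vector ℤ (suc d) ]
                (∀ s → Q s ≡ lin a (λ j → proj₁ (rowPoint j)) s ℤ.+ (A *ᵛ k) s)
    decompose Q = a , k , λ s → ℤₚ.*-cancelˡ-≡ (+ N) (Q s) (lin a Qᵍ s ℤ.+ (A *ᵛ k) s) {{ℤ.≢-nonZero (ℕ.≢-nonZero⁻¹ N ∘ ℤₚ.+-injective)}}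
        (trans (sym (Az≡NQ s)) (scaled-modular g Qᵍ (λ j → proj₂ (rowPoint j)) {z} (a , k , z≡) s))
      where
      open ≡-Reasoning
      Qᵍ : Fin r → Vector ℤ (suc d)
      Qᵍ j = proj₁ (rowPoint j)

      z q : Vector ℤ (suc d)
      z = proj₁ (scaledPreimage isN Q)
      q i = z i ℤ-DivMod./ℕ N

      Az≡NQ : Scaled N z Q
      Az≡NQ = proj₂ (scaledPreimage isN Q)

      c : Word N (suc d)
      c i = reduce (z i)

      Ac : Scaled N (λ i → + toℕ (c i)) (λ s → Q s ℤ.+ (A *ᵛ (ℤ.-_ ∘ q)) s)
      Ac s = begin
        (A *ᵛ λ i → + toℕ (c i)) s                        ≡⟨ *ᵛ-cong A (λ i → reduce-eq (z i)) s ⟩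
        (A *ᵛ λ i → z i ℤ.+ + N ℤ.* ℤ.- q i) s            ≡⟨ *ᵛ-+ A z (λ i → + N ℤ.* ℤ.- q i) s ⟩
        (A *ᵛ z) s ℤ.+ (A *ᵛ λ i → + N ℤ.* ℤ.- q i) s     ≡⟨ cong₂ ℤ._+_ (Az≡NQ s) (*ᵛ-* A (+ N) (ℤ.-_ ∘ q) s) ⟩
        + N ℤ.* Q s ℤ.+ + N ℤ.* (A *ᵛ (ℤ.-_ ∘ q)) s       ≡⟨ ℤₚ.*-distribˡ-+ (+ N) (Q s) _ ⟨
        + N ℤ.* (Q s ℤ.+ (A *ᵛ (ℤ.-_ ∘ q)) s)             ∎

      c∈span : ModularSpan g (λ i → + toℕ (c i))
      c∈span = rowSpan⇒modular g c (Equivalence.from (generates c)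
        (scaled⇒inCode isN c (λ s → Q s ℤ.+ (A *ᵛ (ℤ.-_ ∘ q)) s) Ac))

      a : Vector ℤ r
      a = proj₁ c∈span

      -- Two multiples of N have been split off, one in reducing z to the word c and one in
      -- expanding c along the rows; both go to the vertices.
      k : Vector ℤ (suc d)
      k i = proj₁ (proj₂ c∈span) i ℤ.+ q i

      z≡ : ∀ i → z i ≡ lin a (rows g) i ℤ.+ + N ℤ.* k i
      z≡ i = begin
        z i                                              ≡⟨ restore (z i) (+ N) (q i) ⟩
        (z i ℤ.+ + N ℤ.* ℤ.- q i) ℤ.+ + N ℤ.* q i        ≡⟨ cong (ℤ._+ + N ℤ.* q i) (reduce-eq (z i)) ⟨
        + toℕ (c i) ℤ.+ + N ℤ.* q i                      ≡⟨ cong (ℤ._+ + N ℤ.* q i) (proj₂ (proj₂ c∈span) i) ⟩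
        (lin a (rows g) i ℤ.+ + N ℤ.* proj₁ (proj₂ c∈span) i) ℤ.+ + N ℤ.* q i
                                                         ≡⟨ collect (lin a (rows g) i) (+ N) (proj₁ (proj₂ c∈span) i) (q i) ⟩
        lin a (rows g) i ℤ.+ + N ℤ.* k i                 ∎
        where
        restore : ∀ z n q → z ≡ (z ℤ.+ n ℤ.* ℤ.- q) ℤ.+ n ℤ.* q
        restore = solve-∀
        collect : ∀ y n k q → (y ℤ.+ n ℤ.* k) ℤ.+ n ℤ.* q ≡ y ℤ.+ n ℤ.* (k ℤ.+ q)
        collect = solve-∀

    generates⇒spanning : Spanning Δ
    generates⇒spanning (m , h) =
      r ℕ.+ suc d , generators , generators-lattice , a ++ k ,
      (λ j → coordinate (suc j) (λ p → proj₁ p j) λ _ → refl) , coordinate zero proj₂ λ _ → refl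
      where
      a = proj₁ (decompose (h ∷ m))
      k = proj₁ (proj₂ (decompose (h ∷ m)))

      -- The projection `π` treats the level and the coordinates of the point alike, although pairs
      -- in `M⊕ℤ` store them separately.
      coordinate : ∀ s (π : M⊕ℤ d → ℤ) → (∀ Q → π (fromHomogeneous Q) ≡ Q s) →
                   (h ∷ m) s ≡ ∑ᶻ λ l → (a ++ k) l ℤ.* π (generators l)
      coordinate s π π-eq = begin
        (h ∷ m) s
          ≡⟨ proj₂ (proj₂ (decompose (h ∷ m))) s ⟩
        lin a (λ j → proj₁ (rowPoint j)) s ℤ.+ (A *ᵛ k) s
          ≡⟨ cong₂ ℤ._+_
               (sum-cong-≗ λ j → cong₂ ℤ._*_ (lookup-++ˡ a k j)
                 (trans (cong π (lookup-++ˡ rowPoints vertices j)) (π-eq (proj₁ (rowPoint j)))))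
               (sum-cong-≗ λ i → trans (cong₂ ℤ._*_ (lookup-++ʳ a k i)
                 (trans (cong π (lookup-++ʳ rowPoints vertices i)) (π-eq λ s → A s i))) (ℤₚ.*-comm (k i) (A s i))) ⟨
        ∑ᶻ (λ j → f (j ↑ˡ suc d)) ℤ.+ ∑ᶻ (λ i → f (r ↑ʳ i))
          ≡⟨ ∑-split r f ⟨
        ∑ᶻ f ∎
        where
        open ≡-Reasoning
        rowPoints = λ j → fromHomogeneous (proj₁ (rowPoint j))
        vertices = λ i → fromHomogeneous λ s → A s i
        f : Vector ℤ (r ℕ.+ suc d)
        f l = (a ++ k) l ℤ.* π (generators l)

proposition2p15 : ∀ (d : ℕ) (Δ : LatticeSimplex d) (N : ℕ) .{{_ : NonZero N}} →
    IsN Δ N →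
    Spanning Δ ⇔ (∃[ r ] Σ[ g ∈ Vector (Word N (suc d)) r ] (Generates Δ N g × (∀ j → height (g j) ≡ 1ℚ)))
proposition2p15 d Δ N isN = mk⇔
  (λ spanning → length (heightOneIndices Δ isN) , heightOneWords Δ isN , spanning⇒generates Δ isN spanning ,
    λ j → Equivalence.from (height-one Δ isN (heightOneWords Δ isN j)) (proj₁ (heightOneWords-sound Δ isN j)))
  (λ (r , g , generates , heights) → generates⇒spanning Δ isN g generates heights)
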